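{- Let $D\ge 3$. For the folded cube $\square_{2D}$, the Terwilliger algebra $T$ with respect to $\mathbf 0$ coincides with the linear span $\mathcal A$ of the matrices $M^t_{i,j}$, $(i,j,t)\in\mathcal I$; moreover these matrices form a basis of $\mathcal A$.
   Context: Let $S=\{1,\dots,2D\}$, $X$ the set of unordered pairs $\{u,u'\}$ of subsets of $S$ with $u\cap u'=\emptyset$, $u\cup u'=S$. The folded cube $\square_{2D}$ is the graph on $X$ with distance $\partial(x,y)=\min\{|x_1\triangle y_1|,|x_1\triangle y_2|\}$ for $x=\{x_1,x_2\},y=\{y_1,y_2\}$ (adjacent iff distance $1$); its diameter is $D$. Let $\mathbf 0=\{\emptyset,S\}$. Write each vertex as $x=(x_1,x_2)$ with parts labeled so that $|x_1|\le|x_2|$ (arbitrarily if $|x_1|=|x_2|=D$). For $x,y\in X$ put $\partial(\mathbf 0,x,y)=(i,j,t)$ where $i=|x_1|$, $j=|y_1|$ and $t=|x_1\cap y_1|$ if $i,j\le D-1$; $t=\max\{|x_1\cap y_1|,|x_2\cap y_1|\}$ if $i=D$, $j\le D-1$; $t=\max\{|x_1\cap y_1|,|x_1\cap y_2|\}$ if $i\le D-1$, $j=D$ or if $i=j=D$. Let $\mathcal I=\{(i,j,t): 0\le t\le i,j\le D,\ i+j-t\le 2D-2,\ t\ge\lfloor (j+1)/2\rfloor \text{ if } i=D,\ t\ge\lfloor (i+1)/2\rfloor\text{ if } j=D\}$. For $(i,j,t)\in\mathcal I$, $M^t_{i,j}$ is the $X\times X$ matrix with $(x,y)$-entry $1$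 if $\partial(\mathbf 0,x,y)=(i,j,t)$ and $0$ otherwise. For $0\le k\le D$, $A_k$ is the distance-$k$ matrix of $\square_{2D}$ and $E^*_k$ the diagonal matrix with $(y,y)$-entry $1$ iff $\partial(\mathbf 0,y)=k$. The Terwilliger algebra $T$ with respect to $\mathbf 0$ is the subalgebra of $\mathrm{Mat}_X(\mathbb C)$ generated by $A_0,\dots,A_D,E^*_0,\dots,E^*_D$. -}

module Defs where

open import Level using (Level) renaming (suc to lsuc; _⊔_ to _⊔ˡ_)
open import Data.Bool using (Bool; true; false; if_then_else_; _∧_; _∨_; not; T?)
open import Data.Nat using (ℕ; zero; suc; _∸_; _≤_; _≤ᵇ_; _≡ᵇ_; _⊓_; _⊔_; ⌊_/2⌋)
open import Data.Nat using () renaming (_+_ to _+ℕ_; _*_ to _*ℕ_)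
open import Data.Product using (_×_; _,_; ∃)
open import Data.List using (List; []; _∷_; map; concatMap; filter; foldr; upTo; _++_)
open import Data.List.Membership.Propositional using (_∈_)
open import Data.Vec using (Vec; []; _∷_; replicate)
open import Data.Fin.Subset using (Subset; inside; outside; ∁; _∩_; _∪_; _─_; ∣_∣)
open import Relation.Nullary using (¬_)
open import Relation.Unary using (Pred)
open import Algebra.Bundles using (CommutativeRing)

natCast : ∀ {c ℓ} (R : CommutativeRing c ℓ) → ℕ → CommutativeRing.Carrier R
natCast R zero    = CommutativeRing.0# R
natCast R (suc n) = CommutativeRing._+_ R (CommutativeRing.1# R) (natCast R n)

record CharZeroField (c ℓ : Level) : Set (lsuc (c ⊔ˡ ℓ)) where
  field
    commutativeRing : CommutativeRing c ℓ
  open CommutativeRing commutativeRing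
  field
    -- every nonzero element is invertible (together with charZero at n = 0,
    -- which gives 1 ≉ 0, this makes the commutative ring a field)
    inverse  : ∀ x → ¬ (x ≈ 0#) → ∃ λ y → (x * y) ≈ 1#
    charZero : ∀ n → ¬ (natCast commutativeRing (suc n) ≈ 0#)
  open CommutativeRing commutativeRing public

allSubsets : ∀ n → List (Subset n)
allSubsets zero    = [] ∷ []
allSubsets (suc n) = map (outside ∷_) (allSubsets n) ++ map (inside ∷_) (allSubsets n)

_≡ˢ_ : ∀ {n} → Subset n → Subset n → Bool
[] ≡ˢ [] = true
(a ∷ as) ≡ˢ (b ∷ bs) = (if a then b else not b) ∧ (as ≡ˢ bs)

_△_ : ∀ {n} → Subset n → Subset n → Subset n
a △ b = (a ─ b) ∪ (b ─ a)

-- The folded cube □_{2D}.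
-- S = {1,…,2D} is modelled by Fin (suc (2*D ∸ 1)) (= Fin (2D) since D ≥ 1);
-- the distinguished element of S is the index 0 (i.e. the element 1).
-- A vertex {u, u'} (u ∩ u' = ∅, u ∪ u' = S) is represented, bijectively,
-- by the part NOT containing element 0, given as a subset of the
-- remaining 2D-1 elements.

module FoldedCube (D : ℕ) where

  m : ℕ
  m = 2 *ℕ D ∸ 1

  SubS : Set
  SubS = Subset (suc m)

  X : Set
  X = Subset m

  vertices : List X
  vertices = allSubsets m

  -- the part of the vertex not containing element 0; the other part is its complement
  part : X → SubS
  part x = outside ∷ x

  dist : X → X → ℕ
  dist x y = ∣ part x △ part y ∣ ⊓ ∣ part x △ ∁ (part y) ∣

  -- 𝟎 = {∅, S}
  𝟎 : X
  𝟎 = replicate m outside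

  -- labelled parts x = (x₁, x₂) with |x₁| ≤ |x₂|  (x₁ = the part containing
  -- no 0-element when |part x| = D, which is an allowed arbitrary choice)
  p₁ : X → SubS
  p₁ x = if ∣ part x ∣ ≤ᵇ D then part x else ∁ (part x)

  p₂ : X → SubS
  p₂ x = ∁ (p₁ x)

  triple : X → X → ℕ × ℕ × ℕ
  triple x y =
    let i = ∣ p₁ x ∣
        j = ∣ p₁ y ∣
        t = if j ≡ᵇ D then ∣ p₁ x ∩ p₁ y ∣ ⊔ ∣ p₁ x ∩ p₂ y ∣
            else if i ≡ᵇ D then ∣ p₁ x ∩ p₁ y ∣ ⊔ ∣ p₂ x ∩ p₁ y ∣
            else ∣ p₁ x ∩ p₁ y ∣
    in i , j , t

  inI : ℕ × ℕ × ℕ → Bool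
  inI (i , j , t) =
    (t ≤ᵇ i) ∧ (t ≤ᵇ j) ∧ (i ≤ᵇ D) ∧ (j ≤ᵇ D)
    ∧ (i +ℕ j ≤ᵇ t +ℕ (2 *ℕ D ∸ 2))
    ∧ (not (i ≡ᵇ D) ∨ (⌊ suc j /2⌋ ≤ᵇ t))
    ∧ (not (j ≡ᵇ D) ∨ (⌊ suc i /2⌋ ≤ᵇ t))

  box : List (ℕ × ℕ × ℕ)
  box = concatMap (λ i → concatMap (λ j → map (λ t → i , j , t) (upTo (suc D)))
                                    (upTo (suc D)))
                  (upTo (suc D))

  𝓘 : List (ℕ × ℕ × ℕ)
  𝓘 = filter (λ τ → T? (inI τ)) box

module Terwilliger {c ℓ : Level} (F : CharZeroField c ℓ) (D : ℕ) where
  open CharZeroField F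
  open FoldedCube D public

  Mat : Set c
  Mat = X → X → Carrier

  _≈ₘ_ : Mat → Mat → Set ℓ
  A ≈ₘ B = ∀ x y → A x y ≈ B x y

  sumL : {A : Set} → List A → (A → Carrier) → Carrier
  sumL xs f = foldr (λ a r → f a + r) 0# xs

  _⊕_ : Mat → Mat → Mat
  (A ⊕ B) x y = A x y + B x y

  _•_ : Carrier → Mat → Mat
  (a • A) x y = a * A x y

  _⊗_ : Mat → Mat → Mat
  (A ⊗ B) x y = sumL vertices (λ z → A x z * B z y)

  𝟘 : Mat
  𝟘 x y = 0#

  indicator : Bool → Carrier
  indicator true  = 1#
  indicator false = 0#

  _≡ᵇ³_ : ℕ × ℕ × ℕ → ℕ × ℕ × ℕ → Bool
  (a , b , e) ≡ᵇ³ (a' , b' , e') = (a ≡ᵇ a') ∧ (b ≡ᵇ b') ∧ (e ≡ᵇ e')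

  Adist : ℕ → Mat
  Adist k x y = indicator (dist x y ≡ᵇ k)

  Estar : ℕ → Mat
  Estar k x y = indicator ((x ≡ˢ y) ∧ (dist 𝟎 y ≡ᵇ k))

  Mtij : ℕ × ℕ × ℕ → Mat
  Mtij τ x y = indicator (triple x y ≡ᵇ³ τ)

  data InT : Mat → Set (c ⊔ˡ ℓ) where
    genA : ∀ k → k ≤ D → InT (Adist k)
    genE : ∀ k → k ≤ D → InT (Estar k)
    add  : ∀ {A B} → InT A → InT B → InT (A ⊕ B)
    smul : ∀ a {A} → InT A → InT (a • A)
    mul  : ∀ {A B} → InT A → InT B → InT (A ⊗ B)
    resp : ∀ {A B} → A ≈ₘ B → InT A → InT B

  combo : (ℕ × ℕ × ℕ → Carrier) → Mat
  combo coef x y = sumL 𝓘 (λ τ → coef τ * Mtij τ x y)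

  InA : Mat → Set (c ⊔ˡ ℓ)
  InA M = ∃ λ coef → M ≈ₘ combo coef

  LinIndep : Set (c ⊔ˡ ℓ)
  LinIndep = ∀ coef → combo coef ≈ₘ 𝟘 → ∀ τ → τ ∈ 𝓘 → coef τ ≈ 0#

{-# OPTIONS --safe #-}
-- The stabiliser of 𝟎 is the symmetric group of S, which fixes the generators of T, so
-- every matrix in T is constant on the orbits of Sym(S) on X × X. These orbits are exactly the
-- nonempty fibres of the triple, and 𝓘 is the set of triples that occur; this gives T ⊆ A and
-- the linear independence. For A ⊆ T, if i = D or j = D then t is determined by the distance
-- and M^t_ij = E*_i A_{i+j-2t} E*_j. If i, j < D, then the entries of
-- E*_i A_{i-t} E*_t A_{j-t} E*_j count the t-subsets of x₁ ∩ y₁, so that this product is M^t_ij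
-- plus a combination of the M^s_ij with s > t, and downward induction on t applies.

module Submission where

open import Defs
open import Level using (Level)
open import Data.Nat using (ℕ; _≤_)
open import Data.Product using (_×_)
open import Function.Bundles using (_⇔_)

-- The obstacle is the folding. A vertex is stored as its part without element 0, so permutations
-- that move 0 do not act on the stored sets, and `triple` takes a maximum over choices of parts.
-- Everything is therefore lifted to pairs (u, v) of subsets of S: among the lifts of (x, y) there
-- is a `Normal` one whose triple is simply (|u|, |v|, |u ∩ v|), and all normal lifts agree on it.
-- The restriction i, j < D in the second half of A ⊆ T comes from geodesics: below level D, a
-- vertex on a geodesic from 𝟎 to x is a subset of x₁, whereas in level D both parts of x carry
-- geodesics. The entries binom(s, t) of the product are never computed. Its membership in T already
-- gives its expansion, so only the value 1 at s = t and the value 0 for s < t have to be found.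

module Combinatorics where
  open import Data.Bool using (Bool; true; false; not; _∧_; _∨_; T; if_then_else_)
  open import Data.Bool.Properties using (T-∧; not-involutive) renaming (_≟_ to _≟ᵇ_)
  open import Data.Fin.Subset using (Subset; inside; outside; ∁; _∩_; _∪_; _─_; ∣_∣)
  open import Data.Fin.Subset.Properties using (∩-comm; ∣p∩q∣≤∣p∣; ∣p∩q∣≤∣q∣)
  open import Data.List using () renaming ([] to ε; _∷_ to _﹐_)
  open import Data.Nat using (ℕ; zero; suc; _+_; _*_; _∸_; _≤_; _<_; _⊓_; _⊔_; ⌈_/2⌉; _≡ᵇ_; _≤ᵇ_; z≤n; s≤s)
  open import Data.Nat.Properties
  open import Data.Nat.Tactic.RingSolver using (solve; solve-∀)
  open import Data.Product using (∃; ∃₂; _×_; _,_; proj₁; proj₂)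
  open import Data.Product.Properties using (≡-dec)
  open import Data.Sum using (_⊎_; inj₁; inj₂)
  open import Data.Unit using (tt)
  open import Data.Vec using (Vec; []; _∷_; map; zipWith; zip; count; replicate)
  open import Data.Vec.Properties using (map-∘; map-cong; map-id; map-proj₁-zip; map-proj₂-zip)
  open import Function using (_∘_)
  open import Function.Bundles using (Equivalence)
  open import Relation.Binary.Definitions using (DecidableEquality)
  open import Relation.Binary.PropositionalEquality
  open import Relation.Nullary using (yes; no; ¬_; contradiction)

  private variable
    n : ℕ
    A B C : Set

  -- Permutations of coordinates and their orbits on vectors

  -- Words in adjacent transpositions instead of bijections of Fin n: invariance of cardinalities
  -- and sums becomes an induction whose only real case is `swap`, and inverses never enter.
  data Perm : ℕ → Set where
    done  : Perm n
    prep  : Perm n → Perm (suc n)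
    swap  : Perm (suc (suc n))
    _then_ : Perm n → Perm n → Perm n

  act : Perm n → Vec A n → Vec A n
  act done       v           = v
  act (prep π)   (a ∷ v)     = a ∷ act π v
  act swap       (a ∷ b ∷ v) = b ∷ a ∷ v
  act (π then ρ) v           = act ρ (act π v)

  act-map : (f : A → B) (π : Perm n) (v : Vec A n) → act π (map f v) ≡ map f (act π v)
  act-map f done       v           = refl
  act-map f (prep π)   (a ∷ v)     = cong (f a ∷_) (act-map f π v)
  act-map f swap       (a ∷ b ∷ v) = refl
  act-map f (π then ρ) v           = trans (cong (act ρ) (act-map f π v)) (act-map f ρ (act π v))

  act-zipWith : (f : A → B → C) (π : Perm n) (v : Vec A n) (w : Vec B n) →
                zipWith f (act π v) (act π w) ≡ act π (zipWith f v w)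
  act-zipWith f done       v           w           = refl
  act-zipWith f (prep π)   (a ∷ v)     (b ∷ w)     = cong (f a b ∷_) (act-zipWith f π v w)
  act-zipWith f swap       (a ∷ _ ∷ v) (b ∷ _ ∷ w) = refl
  act-zipWith f (π then ρ) v           w           =
    trans (act-zipWith f ρ (act π v) (act π w)) (cong (act ρ) (act-zipWith f π v w))

  act-replicate : (π : Perm n) (a : A) → act π (replicate n a) ≡ replicate n a
  act-replicate done       a = refl
  act-replicate (prep π)   a = cong (a ∷_) (act-replicate π a)
  act-replicate swap       a = refl
  act-replicate (π then ρ) a = trans (cong (act ρ) (act-replicate π a)) (act-replicate ρ a)

  module _ (_≟_ : DecidableEquality A) where

    occurrences : A → Vec A n → ℕ
    occurrences a = count (a ≟_)

    occurrences-act : ∀ a (π : Perm n) (v : Vec A n) → occurrences a (act π v) ≡ occurrences a v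
    occurrences-act a done       v = refl
    occurrences-act a (prep π)   (b ∷ v) with a ≟ b
    ... | yes _ = cong suc (occurrences-act a π v)
    ... | no  _ = occurrences-act a π v
    occurrences-act a swap       (b ∷ c ∷ v) with a ≟ b | a ≟ c
    ... | yes _ | yes _ = refl
    ... | yes _ | no  _ = refl
    ... | no  _ | yes _ = refl
    ... | no  _ | no  _ = refl
    occurrences-act a (π then ρ) v = trans (occurrences-act a ρ (act π v)) (occurrences-act a π v)

    -- The first occurrence of a travels left one place at a time: `prep π` brings it to the second
    -- position, `swap` to the first.
    bring-to-front : ∀ a (v : Vec A (suc n)) → ¬ (occurrences a v ≡ 0) →
                     ∃₂ λ π v′ → act π v ≡ a ∷ v′
    bring-to-front a (b ∷ v) occurs with a ≟ b
    bring-to-front a (b ∷ v) occurs         | yes refl = done , v , refl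
    bring-to-front a (b ∷ []) occurs        | no _     = contradiction refl occurs
    bring-to-front a (b ∷ v@(_ ∷ _)) occurs | no _     with bring-to-front a v occurs
    ... | π , v′ , eq = (prep π then swap) , b ∷ v′ , cong (λ w → act swap (b ∷ w)) eq

    occurrences-head : ∀ a (w : Vec A n) → ¬ (occurrences a (a ∷ w) ≡ 0)
    occurrences-head a w with a ≟ a
    ... | yes _  = 1+n≢0
    ... | no a≢a = contradiction refl a≢a

    occurrences-tail : ∀ a b (v w : Vec A n) →
                       occurrences a (b ∷ v) ≡ occurrences a (b ∷ w) → occurrences a v ≡ occurrences a w
    occurrences-tail a b v w eq with a ≟ b
    ... | yes _ = suc-injective eq
    ... | no  _ = eq

    -- Selection sort: the head of w is brought to the front of v, and the tails again have equal
    -- counts because the action preserves counts.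
    same-occurrences⇒orbit : (v w : Vec A n) → (∀ a → occurrences a v ≡ occurrences a w) →
                             ∃ λ π → act π v ≡ w
    same-occurrences⇒orbit []        []      same = done , refl
    same-occurrences⇒orbit v@(_ ∷ _) (a ∷ w) same
      with bring-to-front a v (occurrences-head a w ∘ trans (sym (same a)))
    ... | π , v′ , eq
      with same-occurrences⇒orbit v′ w (λ b → occurrences-tail b a v′ w
             (trans (trans (cong (occurrences b) (sym eq)) (occurrences-act b π v)) (same b)))
    ... | ρ , eq′ = (π then prep ρ) , trans (cong (act (prep ρ)) eq) (cong (a ∷_) eq′)

  -- Venn cells of two subsets

  ∁-involutive : (u : Subset n) → ∁ (∁ u) ≡ u
  ∁-involutive u = trans (sym (map-∘ not not u)) (trans (map-cong not-involutive u) (map-id u))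

  card-act : (π : Perm n) (u : Subset n) → ∣ act π u ∣ ≡ ∣ u ∣
  card-act done       u             = refl
  card-act (prep π)   (inside  ∷ u) = cong suc (card-act π u)
  card-act (prep π)   (outside ∷ u) = card-act π u
  card-act swap (inside  ∷ inside  ∷ u) = refl
  card-act swap (inside  ∷ outside ∷ u) = refl
  card-act swap (outside ∷ inside  ∷ u) = refl
  card-act swap (outside ∷ outside ∷ u) = refl
  card-act (π then ρ) u = trans (card-act ρ (act π u)) (card-act π u)

  -- The four cells of the Venn diagram; the digits record membership in u and in v.
  module _ (u v : Subset n) where
    11# 10# 01# 00# : ℕ
    11# = ∣ u ∩ v ∣
    10# = ∣ u ∩ ∁ v ∣
    01# = ∣ ∁ u ∩ v ∣
    00# = ∣ ∁ u ∩ ∁ v ∣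

  card-∩-∁ : (u v : Subset n) → ∣ u ∣ ≡ 11# u v + 10# u v
  card-∩-∁ []            []            = refl
  card-∩-∁ (inside  ∷ u) (inside  ∷ v) = cong suc (card-∩-∁ u v)
  card-∩-∁ (inside  ∷ u) (outside ∷ v) = trans (cong suc (card-∩-∁ u v)) (sym (+-suc _ _))
  card-∩-∁ (outside ∷ u) (inside  ∷ v) = card-∩-∁ u v
  card-∩-∁ (outside ∷ u) (outside ∷ v) = card-∩-∁ u v

  card-∩-∁ʳ : (u v : Subset n) → ∣ v ∣ ≡ 11# u v + 01# u v
  card-∩-∁ʳ u v = trans (card-∩-∁ v u) (cong₂ _+_ (cong ∣_∣ (∩-comm v u)) (cong ∣_∣ (∩-comm v (∁ u))))

  card-∁ : (u : Subset n) → ∣ u ∣ + ∣ ∁ u ∣ ≡ n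
  card-∁ []            = refl
  card-∁ (inside  ∷ u) = cong suc (card-∁ u)
  card-∁ (outside ∷ u) = trans (+-suc _ _) (cong suc (card-∁ u))

  card-△ : (u v : Subset n) → ∣ u △ v ∣ ≡ 10# u v + 01# u v
  card-△ []            []            = refl
  card-△ (inside  ∷ u) (inside  ∷ v) = card-△ u v
  card-△ (inside  ∷ u) (outside ∷ v) = cong suc (card-△ u v)
  card-△ (outside ∷ u) (inside  ∷ v) = trans (cong suc (card-△ u v)) (sym (+-suc _ _))
  card-△ (outside ∷ u) (outside ∷ v) = card-△ u v

  card-△-∁ : (u v : Subset n) → ∣ u △ ∁ v ∣ ≡ 11# u v + 00# u v
  card-△-∁ u v = trans (card-△ u (∁ v)) (cong (λ w → ∣ u ∩ w ∣ + ∣ ∁ u ∩ ∁ v ∣) (∁-involutive v))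

  △-empty⇒≡ : (u v : Subset n) → ∣ u △ v ∣ ≡ 0 → u ≡ v
  △-empty⇒≡ []            []            _  = refl
  △-empty⇒≡ (inside  ∷ u) (inside  ∷ v) eq = cong (inside ∷_) (△-empty⇒≡ u v eq)
  △-empty⇒≡ (outside ∷ u) (outside ∷ v) eq = cong (outside ∷_) (△-empty⇒≡ u v eq)

  _≟ᵖ_ : DecidableEquality (Bool × Bool)
  _≟ᵖ_ = ≡-dec _≟ᵇ_ _≟ᵇ_

  occurrences-zip-11 : (u v : Subset n) → occurrences _≟ᵖ_ (true , true) (zip u v) ≡ 11# u v
  occurrences-zip-11 []            []            = refl
  occurrences-zip-11 (inside  ∷ u) (inside  ∷ v) = cong suc (occurrences-zip-11 u v)
  occurrences-zip-11 (inside  ∷ u) (outside ∷ v) = occurrences-zip-11 u v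
  occurrences-zip-11 (outside ∷ u) (inside  ∷ v) = occurrences-zip-11 u v
  occurrences-zip-11 (outside ∷ u) (outside ∷ v) = occurrences-zip-11 u v

  occurrences-zip-10 : (u v : Subset n) → occurrences _≟ᵖ_ (true , false) (zip u v) ≡ 10# u v
  occurrences-zip-10 []            []            = refl
  occurrences-zip-10 (inside  ∷ u) (inside  ∷ v) = occurrences-zip-10 u v
  occurrences-zip-10 (inside  ∷ u) (outside ∷ v) = cong suc (occurrences-zip-10 u v)
  occurrences-zip-10 (outside ∷ u) (inside  ∷ v) = occurrences-zip-10 u v
  occurrences-zip-10 (outside ∷ u) (outside ∷ v) = occurrences-zip-10 u v

  occurrences-zip-01 : (u v : Subset n) → occurrences _≟ᵖ_ (false , true) (zip u v) ≡ 01# u v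
  occurrences-zip-01 []            []            = refl
  occurrences-zip-01 (inside  ∷ u) (inside  ∷ v) = occurrences-zip-01 u v
  occurrences-zip-01 (inside  ∷ u) (outside ∷ v) = occurrences-zip-01 u v
  occurrences-zip-01 (outside ∷ u) (inside  ∷ v) = cong suc (occurrences-zip-01 u v)
  occurrences-zip-01 (outside ∷ u) (outside ∷ v) = occurrences-zip-01 u v

  occurrences-zip-00 : (u v : Subset n) → occurrences _≟ᵖ_ (false , false) (zip u v) ≡ 00# u v
  occurrences-zip-00 []            []            = refl
  occurrences-zip-00 (inside  ∷ u) (inside  ∷ v) = occurrences-zip-00 u v
  occurrences-zip-00 (inside  ∷ u) (outside ∷ v) = occurrences-zip-00 u v
  occurrences-zip-00 (outside ∷ u) (inside  ∷ v) = occurrences-zip-00 u v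
  occurrences-zip-00 (outside ∷ u) (outside ∷ v) = cong suc (occurrences-zip-00 u v)

  -- The pair is read as one word over the alphabet Bool × Bool whose letter counts are the cell
  -- sizes, so a single permutation serves both sets.
  pair-orbit : (u v u′ v′ : Subset n) →
    11# u v ≡ 11# u′ v′ → 10# u v ≡ 10# u′ v′ → 01# u v ≡ 01# u′ v′ → 00# u v ≡ 00# u′ v′ →
    ∃ λ π → act π u ≡ u′ × act π v ≡ v′
  pair-orbit u v u′ v′ e₁₁ e₁₀ e₀₁ e₀₀
    with same-occurrences⇒orbit _≟ᵖ_ (zip u v) (zip u′ v′) same
    where
    same : ∀ s → occurrences _≟ᵖ_ s (zip u v) ≡ occurrences _≟ᵖ_ s (zip u′ v′)
    same (true  , true)  = trans (occurrences-zip-11 u v) (trans e₁₁ (sym (occurrences-zip-11 u′ v′)))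
    same (true  , false) = trans (occurrences-zip-10 u v) (trans e₁₀ (sym (occurrences-zip-10 u′ v′)))
    same (false , true)  = trans (occurrences-zip-01 u v) (trans e₀₁ (sym (occurrences-zip-01 u′ v′)))
    same (false , false) = trans (occurrences-zip-00 u v) (trans e₀₀ (sym (occurrences-zip-00 u′ v′)))
  ... | π , eq = π
    , component proj₁ (map-proj₁-zip u v) (map-proj₁-zip u′ v′)
    , component proj₂ (map-proj₂-zip u v) (map-proj₂-zip u′ v′)
    where
    component : (f : Bool × Bool → Bool) {w w′ : Subset _} →
                map f (zip u v) ≡ w → map f (zip u′ v′) ≡ w′ → act π w ≡ w′
    component f refl refl = trans (act-map f π (zip u v)) (cong (map f) eq)

  -- Folding subsets of S to vertices

  -- The vertex {u, ∁ u}.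
  fold : Subset (suc n) → Subset n
  fold (outside ∷ u) = u
  fold (inside  ∷ u) = ∁ u

  fold-∁ : (u : Subset (suc n)) → fold (∁ u) ≡ fold u
  fold-∁ (outside ∷ u) = ∁-involutive u
  fold-∁ (inside  ∷ u) = refl

  fold-fibre : (u v : Subset (suc n)) → fold u ≡ fold v → (v ≡ u) ⊎ (v ≡ ∁ u)
  fold-fibre (outside ∷ u) (outside ∷ v) refl = inj₁ refl
  fold-fibre (outside ∷ u) (inside  ∷ v) refl = inj₂ (cong (inside ∷_) (sym (∁-involutive v)))
  fold-fibre (inside  ∷ u) (outside ∷ v) refl = inj₂ refl
  fold-fibre (inside  ∷ u) (inside  ∷ v) eq   =
    inj₁ (cong (inside ∷_) (trans (sym (∁-involutive v)) (trans (cong ∁ (sym eq)) (∁-involutive u))))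

  -- The image of a stored part may contain element 0 and is then replaced by its complement.
  _·_ : Perm (suc n) → Subset n → Subset n
  π · x = fold (act π (outside ∷ x))

  -- The action descends to vertices because permutations commute with complements.
  ·-fold : (π : Perm (suc n)) (u : Subset (suc n)) → π · fold u ≡ fold (act π u)
  ·-fold π (outside ∷ u) = refl
  ·-fold π u@(inside ∷ _) = trans (cong fold (act-map not π u)) (fold-∁ (act π u))

  foldedDist : Subset n → Subset n → ℕ
  foldedDist u v = ∣ u △ v ∣ ⊓ ∣ u △ ∁ v ∣

  foldedDist-venn : (u v : Subset n) → foldedDist u v ≡ (10# u v + 01# u v) ⊓ (11# u v + 00# u v)
  foldedDist-venn u v = cong₂ _⊓_ (card-△ u v) (card-△-∁ u v)

  foldedDist-∁ʳ : (u v : Subset n) → foldedDist u (∁ v) ≡ foldedDist u v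
  foldedDist-∁ʳ u v = trans (⊓-comm ∣ u △ ∁ v ∣ _) (cong (λ w → ∣ u △ w ∣ ⊓ ∣ u △ ∁ v ∣) (∁-involutive v))

  foldedDist-comm : (u v : Subset n) → foldedDist u v ≡ foldedDist v u
  foldedDist-comm u v = trans (foldedDist-venn u v) (trans (cong₂ _⊓_
    (trans (+-comm (10# u v) (01# u v)) (cong₂ _+_ (cong ∣_∣ (∩-comm (∁ u) v)) (cong ∣_∣ (∩-comm u (∁ v)))))
    (cong₂ _+_ (cong ∣_∣ (∩-comm u v)) (cong ∣_∣ (∩-comm (∁ u) (∁ v)))))
    (sym (foldedDist-venn v u)))

  foldedDist-∁ˡ : (u v : Subset n) → foldedDist (∁ u) v ≡ foldedDist u v
  foldedDist-∁ˡ u v = trans (foldedDist-comm (∁ u) v) (trans (foldedDist-∁ʳ v u) (foldedDist-comm v u))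

  -- Complementing either set only exchanges the two arguments of the minimum, so any lifts compute
  -- the distance.
  foldedDist-fold : (u v : Subset (suc n)) → foldedDist (outside ∷ fold u) (outside ∷ fold v) ≡ foldedDist u v
  foldedDist-fold (outside ∷ u)   (outside ∷ v)   = refl
  foldedDist-fold (outside ∷ u)   v@(inside ∷ _)  = foldedDist-∁ʳ (outside ∷ u) v
  foldedDist-fold u@(inside ∷ _)  (outside ∷ v)   = foldedDist-∁ˡ u (outside ∷ v)
  foldedDist-fold u@(inside ∷ _)  v@(inside ∷ _)  = trans (foldedDist-∁ʳ (∁ u) v) (foldedDist-∁ˡ u v)

  △-act : (π : Perm n) (u v : Subset n) → act π u △ act π v ≡ act π (u △ v)
  △-act π u v = trans (cong₂ _∪_ (act-zipWith _ π u v) (act-zipWith _ π v u)) (act-zipWith _ π (u ─ v) (v ─ u))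

  foldedDist-act : (π : Perm n) (u v : Subset n) → foldedDist (act π u) (act π v) ≡ foldedDist u v
  foldedDist-act π u v = cong₂ _⊓_
    (trans (cong ∣_∣ (△-act π u v)) (card-act π (u △ v)))
    (trans (cong (λ w → ∣ act π u △ w ∣) (sym (act-map not π v)))
           (trans (cong ∣_∣ (△-act π u (∁ v))) (card-act π (u △ ∁ v))))

  ≡ˢ-refl : (u : Subset n) → (u ≡ˢ u) ≡ true
  ≡ˢ-refl []            = refl
  ≡ˢ-refl (inside  ∷ u) = ≡ˢ-refl u
  ≡ˢ-refl (outside ∷ u) = ≡ˢ-refl u

  ≡ˢ⇒≡ : (u v : Subset n) → (u ≡ˢ v) ≡ true → u ≡ v
  ≡ˢ⇒≡ []            []            _  = refl
  ≡ˢ⇒≡ (inside  ∷ u) (inside  ∷ v) eq = cong (inside ∷_) (≡ˢ⇒≡ u v eq)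
  ≡ˢ⇒≡ (outside ∷ u) (outside ∷ v) eq = cong (outside ∷_) (≡ˢ⇒≡ u v eq)

  -- Auxiliary arithmetic, inclusions, and profiles of pairs of subsets

  -- A Farkas certificate: with s as slack, the equation is a semiring identity.
  linear : ∀ {L R x y} s → L ≤ R → x + R + s ≡ y + L → x ≤ y
  linear {L} {R} {x} {y} s L≤R eq = +-cancelʳ-≤ L x y
    (≤-trans (+-monoʳ-≤ x L≤R) (≤-trans (m≤m+n (x + R) s) (≤-reflexive eq)))

  -- Meant for the two parts of one vertex: if neither exceeds D, both lie in the middle level.
  both-maximal : ∀ {p q d} → p ≤ d → q ≤ d → p + q ≡ d + d → p ≡ d × q ≡ d
  both-maximal {p} {q} {d} p≤d q≤d eq =
      ≤-antisym p≤d (linear 0 (+-mono-≤ q≤d (≤-reflexive (sym eq))) (solve (p ﹐ q ﹐ d ﹐ ε)))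
    , ≤-antisym q≤d (linear 0 (+-mono-≤ p≤d (≤-reflexive (sym eq))) (solve (p ﹐ q ﹐ d ﹐ ε)))

  ≡ˢ-△ : (u v : Subset n) → (u ≡ˢ v) ≡ (∣ u △ v ∣ ≡ᵇ 0)
  ≡ˢ-△ []            []            = refl
  ≡ˢ-△ (inside  ∷ u) (inside  ∷ v) = ≡ˢ-△ u v
  ≡ˢ-△ (inside  ∷ u) (outside ∷ v) = refl
  ≡ˢ-△ (outside ∷ u) (inside  ∷ v) = refl
  ≡ˢ-△ (outside ∷ u) (outside ∷ v) = ≡ˢ-△ u v

  card-∅-△ : (u : Subset n) → ∣ replicate n outside △ u ∣ ≡ ∣ u ∣
  card-∅-△ []            = refl
  card-∅-△ (inside  ∷ u) = cong suc (card-∅-△ u)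
  card-∅-△ (outside ∷ u) = card-∅-△ u

  -- The inclusion w ⊆ u is expressed by 01# u w ≡ 0.
  01#-∩ˡ : (u v : Subset n) → 01# u (u ∩ v) ≡ 0
  01#-∩ˡ []            []      = refl
  01#-∩ˡ (inside  ∷ u) (_ ∷ v) = 01#-∩ˡ u v
  01#-∩ˡ (outside ∷ u) (_ ∷ v) = 01#-∩ˡ u v

  ⊆∩ : (u v w : Subset n) → 01# u w ≡ 0 → 01# v w ≡ 0 → 01# (u ∩ v) w ≡ 0
  ⊆∩ []            []            []            _ _ = refl
  ⊆∩ (inside  ∷ u) (inside  ∷ v) (_       ∷ w) p q = ⊆∩ u v w p q
  ⊆∩ (inside  ∷ u) (outside ∷ v) (outside ∷ w) p q = ⊆∩ u v w p q
  ⊆∩ (outside ∷ u) (inside  ∷ v) (outside ∷ w) p q = ⊆∩ u v w p q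
  ⊆∩ (outside ∷ u) (outside ∷ v) (outside ∷ w) p q = ⊆∩ u v w p q

  ⊆-card : (s w : Subset n) → 01# s w ≡ 0 → ∣ s ∣ ≡ ∣ w ∣ + 10# s w
  ⊆-card s w eq = trans (card-∩-∁ s w) (cong (_+ 10# s w)
    (sym (trans (card-∩-∁ʳ s w) (trans (cong (11# s w +_) eq) (+-identityʳ _)))))

  ⊆-card-≡ : (s w : Subset n) → 01# s w ≡ 0 → ∣ s ∣ ≡ ∣ w ∣ → s ≡ w
  ⊆-card-≡ s w eq same = △-empty⇒≡ s w (trans (card-△ s w) (cong₂ _+_
    (+-cancelˡ-≡ ∣ w ∣ _ 0 (trans (sym (⊆-card s w eq)) (trans same (sym (+-identityʳ _))))) eq))

  -- Elements are handed out to the cells 11, 10 and 01 in turn; the rest go to cell 00.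
  realize-venn : ∀ n a b c → a + b + c ≤ n →
                 ∃₂ λ (u v : Subset n) → 11# u v ≡ a × 10# u v ≡ b × 01# u v ≡ c
  realize-venn zero    zero zero zero _ = [] , [] , refl , refl , refl
  realize-venn (suc n) (suc a) b c (s≤s p) with realize-venn n a b c p
  ... | u , v , e₁ , e₂ , e₃ = inside ∷ u , inside ∷ v , cong suc e₁ , e₂ , e₃
  realize-venn (suc n) zero (suc b) c (s≤s p) with realize-venn n zero b c p
  ... | u , v , e₁ , e₂ , e₃ = inside ∷ u , outside ∷ v , e₁ , cong suc e₂ , e₃
  realize-venn (suc n) zero zero (suc c) (s≤s p) with realize-venn n zero zero c p
  ... | u , v , e₁ , e₂ , e₃ = outside ∷ u , inside ∷ v , e₁ , e₂ , cong suc e₃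
  realize-venn (suc n) zero zero zero _ with realize-venn n zero zero zero z≤n
  ... | u , v , e₁ , e₂ , e₃ = outside ∷ u , outside ∷ v , e₁ , e₂ , e₃

  ⌈/2⌉≤⇒≤ : ∀ {j t} → ⌈ j /2⌉ ≤ t → j ≤ t + t
  ⌈/2⌉≤⇒≤ {j} p = ≤-trans (≤-reflexive (sym (⌊n/2⌋+⌈n/2⌉≡n j)))
    (+-mono-≤ (≤-trans (⌊n/2⌋≤⌈n/2⌉ j) p) p)

  ≤⇒⌈/2⌉≤ : ∀ {j t} → j ≤ t + t → ⌈ j /2⌉ ≤ t
  ≤⇒⌈/2⌉≤ {j} {t} p = ≤-trans (⌈n/2⌉-mono p) (≤-reflexive (sym (n≡⌈n+n/2⌉ t)))

  -- `not b ∨ c` is how `inI` encodes an implication from P to c, with b deciding P.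
  T-implication : ∀ {P : Set} {b c} → (T b → P) → (P → T b) → T (not b ∨ c) → P → T c
  T-implication {b = true}  _ _    h _ = h
  T-implication {b = false} _ from _ p with () ← from p

  T-implication⁻ : ∀ {P : Set} b {c} → (T b → P) → (P → T c) → T (not b ∨ c)
  T-implication⁻ true  to h = h (to tt)
  T-implication⁻ false to h = tt

  profile : Subset n → Subset n → ℕ × ℕ × ℕ
  profile u v = ∣ u ∣ , ∣ v ∣ , 11# u v

  -- The cells 10 and 01 follow by subtraction, and 00 because both pairs live in the same n-element
  -- set.
  profile-orbit : (u v u′ v′ : Subset n) → profile u v ≡ profile u′ v′ →
                  ∃ λ π → act π u ≡ u′ × act π v ≡ v′
  profile-orbit u v u′ v′ eq = pair-orbit u v u′ v′ e₁₁ e₁₀ e₀₁ e₀₀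
    where
    cancel : ∀ {a b c d e f : ℕ} → a ≡ b + c → d ≡ e + f → a ≡ d → b ≡ e → c ≡ f
    cancel refl refl p refl = +-cancelˡ-≡ _ _ _ p
    eᵤ : ∣ u ∣ ≡ ∣ u′ ∣
    eᵤ = cong proj₁ eq
    eᵥ : ∣ v ∣ ≡ ∣ v′ ∣
    eᵥ = cong (proj₁ ∘ proj₂) eq
    e₁₁ = cong (proj₂ ∘ proj₂) eq
    e₁₀ = cancel (card-∩-∁ u v) (card-∩-∁ u′ v′) eᵤ e₁₁
    e₀₁ = cancel (card-∩-∁ʳ u v) (card-∩-∁ʳ u′ v′) eᵥ e₁₁
    e₀₀ = cancel (card-∩-∁ (∁ u) v) (card-∩-∁ (∁ u′) v′)
            (cancel (sym (card-∁ u)) (sym (card-∁ u′)) refl eᵤ) e₀₁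

  1+2*m∸1≡m+m : ∀ {k m} → suc k ≤ m → suc (2 * m ∸ 1) ≡ m + m
  1+2*m∸1≡m+m (s≤s {n = m} _) = cong (λ e → suc (m + e)) (+-identityʳ (suc m))

  -- Parity: both doubles are even, so the extra 1 is of no use.
  halve-≤ : ∀ {x y} → x + x ≤ suc (y + y) → x ≤ y
  halve-≤ {x} {y} h with ≤-<-connex x y
  ... | inj₁ x≤y = x≤y
  ... | inj₂ y<x with () ← linear {x = 1} {y = 0} 0 (+-mono-≤ (+-mono-≤ y<x y<x) h) (solve (x ﹐ y ﹐ ε))

  -- Every triple that occurs satisfies the inequality i + j - t ≤ 2D - 2 of 𝓘. With both sets below
  -- level D this is immediate. In level D it rests on 3 ≤ D: for D = 2 the triple (2, 2, 1) occurs
  -- and violates it.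
  index-bound : ∀ {D i j t} → 3 ≤ D → i ≤ D → j ≤ D → (i ≡ D → j ≤ t + t) → (j ≡ D → i ≤ t + t) →
                i + j ≤ t + (2 * D ∸ 2)
  index-bound {D} {i} {j} {t} 3≤D i≤D j≤D midˡ midʳ =
    +-cancelˡ-≤ 2 _ _ (≤-trans bound (≤-reflexive (lemma 3≤D)))
    where
    lemma : ∀ {D} → 3 ≤ D → t + (D + D) ≡ 2 + (t + (2 * D ∸ 2))
    lemma (s≤s (s≤s {n = k} _)) = shift t k
      where
      shift : ∀ t k → t + (suc (suc k) + suc (suc k)) ≡ 2 + (t + (k + suc (suc (k + 0))))
      shift = solve-∀
    -- Adding j ≤ D and j ≤ 2t gives 2j ≤ D + 2t; with 3 ≤ D this becomes 2(2 + j) ≤ 2(t + D) + 1,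
    -- and `halve-≤` rounds the 1 away.
    middle : ∀ {j} → j ≤ D → j ≤ t + t → 2 + j ≤ t + D
    middle {j} j≤D h = halve-≤ (linear 0 (+-mono-≤ 3≤D (+-mono-≤ j≤D h)) (solve (D ﹐ j ﹐ t ﹐ ε)))
    bound : 2 + (i + j) ≤ t + (D + D)
    bound with m≤n⇒m<n∨m≡n i≤D | m≤n⇒m<n∨m≡n j≤D
    ... | inj₁ i<D  | inj₁ j<D  = linear t (+-mono-≤ i<D j<D) (solve (D ﹐ i ﹐ j ﹐ t ﹐ ε))
    ... | inj₁ _    | inj₂ refl = linear 0 (middle i≤D (midʳ refl)) (solve (D ﹐ i ﹐ t ﹐ ε))
    ... | inj₂ refl | _         = linear 0 (middle j≤D (midˡ refl)) (solve (D ﹐ j ﹐ t ﹐ ε))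

  -- Here a, b, c, d are the cells 11, 10, 01, 00. The bound y ≤ 2a says c ≤ a, and a + b = c + d
  -- then gives b ≤ d, so the minimum is b + c.
  ⊓-cross : ∀ a b c d {x y} → a + b ≡ x → c + d ≡ x → a + c ≡ y → y ≤ a + a → (b + c) ⊓ (a + d) + (a + a) ≡ x + y
  ⊓-cross a b c d refl q refl h = trans (cong (_+ (a + a)) (m≤n⇒m⊓n≡m b+c≤a+d)) (solve (a ﹐ b ﹐ c ﹐ ε))
    where
    b+c≤a+d : b + c ≤ a + d
    b+c≤a+d = linear 0 (+-mono-≤ (≤-reflexive (sym q)) (+-mono-≤ h h)) (solve (a ﹐ b ﹐ c ﹐ d ﹐ ε))

  ⊓-nested : ∀ a b d {e} → a + b ≤ e → (a + b) + d ≡ e + e → b ⊓ (a + d) ≡ b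
  ⊓-nested a b d {e} h q = m≤n⇒m⊓n≡m
    (linear (a + a) (+-mono-≤ (+-mono-≤ h h) (≤-reflexive (sym q))) (solve (a ﹐ b ﹐ d ﹐ e ﹐ ε)))

  -- Strictness excludes the other branch of the minimum: there c + d ≤ a + b < e, against the total
  -- 2e. For a + b = e that branch is real, since a set inside the complement of u has the same
  -- distance from u as one of equal size inside u.
  ⊓-nested⁻ : ∀ a b c d {e} → a + b < e → (a + b) + (c + d) ≡ e + e → (b + c) ⊓ (a + d) + (a + c) ≡ a + b → c ≡ 0
  ⊓-nested⁻ a b c d {e} h q r with ⊓-sel (b + c) (a + d)
  ... | inj₁ s = n≤0⇒n≡0 (linear c (≤-reflexive (subst (λ q → q + (a + c) ≡ a + b) s r)) (solve (a ﹐ b ﹐ c ﹐ ε)))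
  ... | inj₂ s with () ← linear {x = 1} {y = 0} (suc (a + a))
          (+-mono-≤ (≤-reflexive (subst (λ q → q + (a + c) ≡ a + b) s r)) (+-mono-≤ (≤-reflexive (sym q)) (+-mono-≤ h h)))
          (solve (a ﹐ b ﹐ c ﹐ d ﹐ e ﹐ ε))

  -- Normal lifts and the triple of two vertices

  module Triples (D : ℕ) (3≤D : 3 ≤ D) where
    open FoldedCube D

    size : suc m ≡ D + D
    size = 1+2*m∸1≡m+m 3≤D

    card-total : (u : SubS) → ∣ u ∣ + ∣ ∁ u ∣ ≡ D + D
    card-total u = trans (card-∁ u) size

    card-∁-D : (u : SubS) → ∣ u ∣ ≡ D → ∣ ∁ u ∣ ≡ D
    card-∁-D u eq = +-cancelˡ-≡ D _ _ (trans (cong (_+ ∣ ∁ u ∣) (sym eq)) (card-total u))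

    dist-· : (π : Perm (suc m)) (x y : X) → dist (π · x) (π · y) ≡ dist x y
    dist-· π x y = trans (foldedDist-fold (act π (part x)) (act π (part y))) (foldedDist-act π (part x) (part y))

    ·-𝟎 : (π : Perm (suc m)) → π · 𝟎 ≡ 𝟎
    ·-𝟎 π = cong fold (act-replicate π outside)

    -- `Estar` tests equality of vertices; written as distance 0, the test inherits invariance from
    -- `dist`.
    ≡ˢ-dist : (x y : X) → (x ≡ˢ y) ≡ (dist x y ≡ᵇ 0)
    ≡ˢ-dist x y = trans (≡ˢ-△ x y) (⊓-suc-zero ∣ x △ y ∣ ∣ x △ ∁ y ∣)
      where
      -- The second argument is a successor because element 0 lies in `∁ (part y)` but not in
      -- `part x`.
      ⊓-suc-zero : ∀ a b → (a ≡ᵇ 0) ≡ ((a ⊓ suc b) ≡ᵇ 0)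
      ⊓-suc-zero zero    b = refl
      ⊓-suc-zero (suc a) b = refl

    -- Lifts for which the maximum in `triple` is attained by |u ∩ v| itself: a set in the middle
    -- level contains at least half of the other one.
    record Normal (u v : SubS) : Set where
      field
        cardˡ : ∣ u ∣ ≤ D
        cardʳ : ∣ v ∣ ≤ D
        halfʳ : ∣ u ∣ ≡ D → ∣ v ∣ ≤ 11# u v + 11# u v
        halfˡ : ∣ v ∣ ≡ D → ∣ u ∣ ≤ 11# u v + 11# u v
    open Normal

    fold-p₁ : ∀ x → fold (p₁ x) ≡ x
    fold-p₁ x with ∣ part x ∣ ≤ᵇ D
    ... | true  = refl
    ... | false = fold-∁ (part x)

    card-p₁ : ∀ x → ∣ p₁ x ∣ ≤ D
    card-p₁ x with ∣ part x ∣ ≤ᵇ D in eq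
    ... | true  = ≤ᵇ⇒≤ _ _ (subst T (sym eq) tt)
    ... | false = bound (≰⇒> λ p → subst T eq (≤⇒≤ᵇ p)) (card-total (part x))
      where
      bound : ∀ {p q d} → d < p → p + q ≡ d + d → q ≤ d
      bound {p} {q} {d} d<p e = linear 1 (+-mono-≤ d<p (≤-reflexive e)) (solve (p ﹐ q ﹐ d ﹐ ε))

    -- If a vertex lies in the middle level D, the maximum in the definition of t
    -- selects which of its two parts to use.
    normal-representative : ∀ x y → ∃₂ λ u v →
      fold u ≡ x × fold v ≡ y × Normal u v × triple x y ≡ profile u v
    normal-representative x y = choose (p₁ x) (p₁ y) (fold-p₁ x) (fold-p₁ y) (card-p₁ x) (card-p₁ y)
      where
      larger-half : ∀ {i p q} → i ≡ p + q → q ≤ p → i ≤ p + p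
      larger-half {p = p} refl q≤p = +-monoʳ-≤ p q≤p
      ≡ᵇ-true : ∀ {a b} → (a ≡ᵇ b) ≡ true → a ≡ b
      ≡ᵇ-true eq = ≡ᵇ⇒≡ _ _ (subst T (sym eq) tt)
      ≡ᵇ-false : ∀ {a b} → (a ≡ᵇ b) ≡ false → ¬ (a ≡ b)
      ≡ᵇ-false eq p = subst T eq (≡⇒≡ᵇ _ _ p)
      choose : ∀ u v → fold u ≡ x → fold v ≡ y → ∣ u ∣ ≤ D → ∣ v ∣ ≤ D →
        let t = if ∣ v ∣ ≡ᵇ D then ∣ u ∩ v ∣ ⊔ ∣ u ∩ ∁ v ∣
                else if ∣ u ∣ ≡ᵇ D then ∣ u ∩ v ∣ ⊔ ∣ ∁ u ∩ v ∣
                else ∣ u ∩ v ∣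
        in ∃₂ λ u′ v′ → fold u′ ≡ x × fold v′ ≡ y × Normal u′ v′ × (∣ u ∣ , ∣ v ∣ , t) ≡ profile u′ v′
      choose u v fu fv cu cv with ∣ v ∣ ≡ᵇ D in v-eq
      choose u v fu fv cu cv | true with ≤-total (10# u v) (11# u v) | ≡ᵇ-true v-eq
      ... | inj₁ p | v≡D = u , v , fu , fv
        , record { cardˡ = cu ; cardʳ = cv
                 ; halfʳ = λ u≡D → ≤-trans (≤-reflexive (trans v≡D (sym u≡D))) (larger-half (card-∩-∁ u v) p)
                 ; halfˡ = λ _ → larger-half (card-∩-∁ u v) p }
        , cong (λ t → _ , _ , t) (m≥n⇒m⊔n≡m p)
      ... | inj₂ p | v≡D = u , ∁ v , fu , trans (fold-∁ v) fv
        , record { cardˡ = cu ; cardʳ = ≤-reflexive (card-∁-D v v≡D)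
                 ; halfʳ = λ u≡D → ≤-trans (≤-reflexive (trans (card-∁-D v v≡D) (sym u≡D))) half
                 ; halfˡ = λ _ → half }
        , cong₂ (λ j t → _ , j , t) (trans v≡D (sym (card-∁-D v v≡D))) (m≤n⇒m⊔n≡n p)
        where half = larger-half (trans (card-∩-∁ u v) (+-comm (11# u v) _)) p
      choose u v fu fv cu cv | false with ∣ u ∣ ≡ᵇ D in u-eq
      choose u v fu fv cu cv | false | true with ≤-total (01# u v) (11# u v) | ≡ᵇ-true u-eq
      ... | inj₁ p | u≡D = u , v , fu , fv
        , record { cardˡ = cu ; cardʳ = cv
                 ; halfʳ = λ _ → larger-half (card-∩-∁ʳ u v) p
                 ; halfˡ = λ v≡D → contradiction v≡D (≡ᵇ-false v-eq) }
        , cong (λ t → _ , _ , t) (m≥n⇒m⊔n≡m p)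
      ... | inj₂ p | u≡D = ∁ u , v , trans (fold-∁ u) fu , fv
        , record { cardˡ = ≤-reflexive (card-∁-D u u≡D) ; cardʳ = cv
                 ; halfʳ = λ _ → larger-half (trans (card-∩-∁ʳ u v) (+-comm (11# u v) _)) p
                 ; halfˡ = λ v≡D → contradiction v≡D (≡ᵇ-false v-eq) }
        , cong₂ (λ i t → i , _ , t) (trans u≡D (sym (card-∁-D u u≡D))) (m≤n⇒m⊔n≡n p)
      choose u v fu fv cu cv | false | false = u , v , fu , fv
        , record { cardˡ = cu ; cardʳ = cv
                 ; halfʳ = λ u≡D → contradiction u≡D (≡ᵇ-false u-eq)
                 ; halfˡ = λ v≡D → contradiction v≡D (≡ᵇ-false v-eq) }
        , refl

    balanced : ∀ {i p q} → i ≡ p + q → i ≤ p + p → i ≤ q + q → p ≡ q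
    balanced {p = p} {q} refl h k = ≤-antisym (+-cancelʳ-≤ q p q k) (+-cancelˡ-≤ p q p h)

    -- Normal lifts of the same vertices differ by complements. Complementing one set forces it into
    -- level D, and the half conditions of the two lifts then split the other set evenly
    -- (`balanced`). Complementing both preserves |u ∩ v| because |u| = |∁ v|.
    profile-unique : ∀ {u v u′ v′} → Normal u v → Normal u′ v′ →
                     fold u ≡ fold u′ → fold v ≡ fold v′ → profile u v ≡ profile u′ v′
    profile-unique {u} {v} {u′} {v′} N N′ eu ev with fold-fibre u u′ eu | fold-fibre v v′ ev
    ... | inj₁ refl | inj₁ refl = refl
    ... | inj₂ refl | inj₁ refl with both-maximal (cardˡ N) (cardˡ N′) (card-total u)
    ...   | p , q = cong₂ (λ i t → i , ∣ v ∣ , t) (trans p (sym q))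
                      (balanced (card-∩-∁ʳ u v) (halfʳ N p) (halfʳ N′ q))
    profile-unique {u} {v} N N′ _ _ | inj₁ refl | inj₂ refl with both-maximal (cardʳ N) (cardʳ N′) (card-total v)
    ...   | p , q = cong₂ (λ j t → ∣ u ∣ , j , t) (trans p (sym q))
                      (balanced (card-∩-∁ u v) (halfˡ N p) (halfˡ N′ q))
    profile-unique {u} {v} N N′ _ _ | inj₂ refl | inj₂ refl
      with both-maximal (cardˡ N) (cardˡ N′) (card-total u) | both-maximal (cardʳ N) (cardʳ N′) (card-total v)
    ...   | p , q | r , s = cong₂ _,_ (trans p (sym q)) (cong₂ _,_ (trans r (sym s))
            (+-cancelˡ-≡ (10# u v) _ _ (trans (+-comm (10# u v) _)
               (trans (trans (sym (card-∩-∁ u v)) (trans p (sym s))) (card-∩-∁ʳ u (∁ v))))))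

    triple-fold : ∀ {u v} → Normal u v → triple (fold u) (fold v) ≡ profile u v
    triple-fold {u} {v} N with normal-representative (fold u) (fold v)
    ... | _ , _ , fu , fv , N′ , eq = trans eq (profile-unique N′ N fu fv)

    orbit : ∀ x y x′ y′ → triple x y ≡ triple x′ y′ → ∃ λ π → π · x ≡ x′ × π · y ≡ y′
    orbit x y x′ y′ eq with normal-representative x y | normal-representative x′ y′
    ... | u , v , refl , refl , _ , e | u′ , v′ , refl , refl , _ , e′
      with profile-orbit u v u′ v′ (trans (sym e) (trans eq e′))
    ... | π , refl , refl = π , ·-fold π u , ·-fold π v

    -- The index set 𝓘 as the set of occurring triples

    -- Propositional form of `inI`, with the bound ⌊(j + 1)/2⌋ ≤ t rewritten as j ≤ t + t.
    record Index (i j t : ℕ) : Set where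
      field
        t≤i   : t ≤ i
        t≤j   : t ≤ j
        i≤D   : i ≤ D
        j≤D   : j ≤ D
        small : i + j ≤ t + (2 * D ∸ 2)
        midˡ  : i ≡ D → j ≤ t + t
        midʳ  : j ≡ D → i ≤ t + t
    open Index

    index : ∀ i j t → T (inI (i , j , t)) → Index i j t
    index i j t h₀ =
      let (h₁ , h) = Equivalence.to T-∧ h₀
          (h₂ , h) = Equivalence.to T-∧ h
          (h₃ , h) = Equivalence.to T-∧ h
          (h₄ , h) = Equivalence.to T-∧ h
          (h₅ , h) = Equivalence.to T-∧ h
          (h₆ , h₇) = Equivalence.to T-∧ h
      in record
        { t≤i = ≤ᵇ⇒≤ _ _ h₁ ; t≤j = ≤ᵇ⇒≤ _ _ h₂ ; i≤D = ≤ᵇ⇒≤ _ _ h₃ ; j≤D = ≤ᵇ⇒≤ _ _ h₄ ; small = ≤ᵇ⇒≤ _ _ h₅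
        ; midˡ = λ p → ⌈/2⌉≤⇒≤ (≤ᵇ⇒≤ _ _ (T-implication (≡ᵇ⇒≡ i D) (≡⇒≡ᵇ i D) h₆ p))
        ; midʳ = λ p → ⌈/2⌉≤⇒≤ (≤ᵇ⇒≤ _ _ (T-implication (≡ᵇ⇒≡ j D) (≡⇒≡ᵇ j D) h₇ p)) }

    index⁻ : ∀ i j t → Index i j t → T (inI (i , j , t))
    index⁻ i j t I =
      (≤⇒≤ᵇ (t≤i I)) & (≤⇒≤ᵇ (t≤j I)) & (≤⇒≤ᵇ (i≤D I)) & (≤⇒≤ᵇ (j≤D I)) & (≤⇒≤ᵇ (small I))
      & T-implication⁻ (i ≡ᵇ D) (≡ᵇ⇒≡ i D) (≤⇒≤ᵇ ∘ ≤⇒⌈/2⌉≤ ∘ midˡ I)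
      & T-implication⁻ (j ≡ᵇ D) (≡ᵇ⇒≡ j D) (≤⇒≤ᵇ ∘ ≤⇒⌈/2⌉≤ ∘ midʳ I)
      where
      infixr 5 _&_
      _&_ : ∀ {b c} → T b → T c → T (b ∧ c)
      p & q = Equivalence.from T-∧ (p , q)

    normal-index : ∀ {u v} → Normal u v → Index ∣ u ∣ ∣ v ∣ (11# u v)
    normal-index {u} {v} N = record
      { t≤i = ∣p∩q∣≤∣p∣ u v ; t≤j = ∣p∩q∣≤∣q∣ u v ; i≤D = cardˡ N ; j≤D = cardʳ N
      ; small = index-bound 3≤D (cardˡ N) (cardʳ N) (halfʳ N) (halfˡ N)
      ; midˡ = halfʳ N ; midʳ = halfˡ N }

    realize : ∀ {i j t} → Index i j t → ∃₂ λ u v → Normal u v × profile u v ≡ (i , j , t)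
    realize {i} {j} {t} I with realize-venn (suc m) t (i ∸ t) (j ∸ t) fits
      where
      fits : t + (i ∸ t) + (j ∸ t) ≤ suc m
      fits = ≤-trans (+-mono-≤ (≤-trans (≤-reflexive (m+[n∸m]≡n (t≤i I))) (i≤D I)) (≤-trans (m∸n≤m j t) (j≤D I)))
                     (≤-reflexive (sym size))
    ... | u , v , e₁₁ , e₁₀ , e₀₁ = u , v , normal eᵤ eᵥ e₁₁ , cong₂ _,_ eᵤ (cong₂ _,_ eᵥ e₁₁)
      where
      eᵤ : ∣ u ∣ ≡ i
      eᵤ = trans (card-∩-∁ u v) (trans (cong₂ _+_ e₁₁ e₁₀) (m+[n∸m]≡n (t≤i I)))
      eᵥ : ∣ v ∣ ≡ j
      eᵥ = trans (card-∩-∁ʳ u v) (trans (cong₂ _+_ e₁₁ e₀₁) (m+[n∸m]≡n (t≤j I)))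
      normal : ∣ u ∣ ≡ i → ∣ v ∣ ≡ j → 11# u v ≡ t → Normal u v
      normal refl refl refl = record { cardˡ = i≤D I ; cardʳ = j≤D I ; halfʳ = midˡ I ; halfˡ = midʳ I }

    -- Distances from the levels, and geodesics from 𝟎

    dist-fold : ∀ u v → dist (fold u) (fold v) ≡ (10# u v + 01# u v) ⊓ (11# u v + 00# u v)
    dist-fold u v = trans (foldedDist-fold u v) (foldedDist-venn u v)

    dist-comm : ∀ x y → dist x y ≡ dist y x
    dist-comm x y = foldedDist-comm (part x) (part y)

    dist-𝟎 : ∀ u → ∣ u ∣ ≤ D → dist 𝟎 (fold u) ≡ ∣ u ∣
    dist-𝟎 u u≤D = trans (foldedDist-fold (replicate (suc m) outside) u)
      (trans (cong₂ _⊓_ (card-∅-△ u) (card-∅-△ (∁ u))) (m≤n⇒m⊓n≡m (≤-trans u≤D (≮⇒≥ λ small →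
        <-irrefl (card-total u) (+-mono-≤-< u≤D small)))))

    -- A middle-level set and its complement have equal size, so the half condition makes |u △ v|
    -- the smaller branch of the distance. The second case is the mirror image, with the cells 10
    -- and 01 exchanged.
    dist-middle : ∀ {u v} → Normal u v → ∣ u ∣ ≡ D ⊎ ∣ v ∣ ≡ D →
                  dist (fold u) (fold v) + (11# u v + 11# u v) ≡ ∣ u ∣ + ∣ v ∣
    dist-middle {u} {v} N (inj₁ u≡D) = trans (cong (_+ (11# u v + 11# u v)) (dist-fold u v))
      (⊓-cross (11# u v) (10# u v) (01# u v) (00# u v) (sym (card-∩-∁ u v))
               (trans (sym (card-∩-∁ (∁ u) v)) (trans (card-∁-D u u≡D) (sym u≡D)))
               (sym (card-∩-∁ʳ u v)) (halfʳ N u≡D))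
    dist-middle {u} {v} N (inj₂ v≡D) =
      trans (cong (_+ (11# u v + 11# u v)) (trans (dist-fold u v) (cong (_⊓ (11# u v + 00# u v)) (+-comm (10# u v) (01# u v)))))
      (trans (⊓-cross (11# u v) (01# u v) (10# u v) (00# u v) (sym (card-∩-∁ʳ u v))
               (trans (sym (card-∩-∁ʳ u (∁ v))) (trans (card-∁-D v v≡D) (sym v≡D)))
               (sym (card-∩-∁ u v)) (halfˡ N v≡D))
             (+-comm ∣ v ∣ ∣ u ∣))

    dist-⊆ : ∀ u w → ∣ u ∣ ≤ D → 01# u w ≡ 0 → dist (fold u) (fold w) ≡ ∣ u ∣ ∸ ∣ w ∣
    dist-⊆ u w u≤D w⊆u = begin
      dist (fold u) (fold w)        ≡⟨ dist-fold u w ⟩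
      (b + 01# u w) ⊓ (a + 00# u w) ≡⟨ cong (λ c → (b + c) ⊓ (a + 00# u w)) w⊆u ⟩
      (b + 0) ⊓ (a + 00# u w)       ≡⟨ cong (_⊓ (a + 00# u w)) (+-identityʳ b) ⟩
      b ⊓ (a + 00# u w)             ≡⟨ ⊓-nested a b (00# u w) (subst (_≤ D) (card-∩-∁ u w) u≤D) total ⟩
      b                             ≡⟨ m+n∸m≡n ∣ w ∣ b ⟨
      ∣ w ∣ + b ∸ ∣ w ∣             ≡⟨ cong (_∸ ∣ w ∣) (⊆-card u w w⊆u) ⟨
      ∣ u ∣ ∸ ∣ w ∣                 ∎
      where
      open ≡-Reasoning
      a = 11# u w
      b = 10# u w
      total : a + b + 00# u w ≡ D + D
      total = trans (cong₂ _+_ (sym (card-∩-∁ u w)) (sym (trans (card-∩-∁ (∁ u) w) (cong (_+ 00# u w) w⊆u)))) (card-total u)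

    dist-⊆⁻ : ∀ u w → ∣ u ∣ < D → ∣ w ∣ ≤ ∣ u ∣ → dist (fold u) (fold w) ≡ ∣ u ∣ ∸ ∣ w ∣ → 01# u w ≡ 0
    dist-⊆⁻ u w u<D w≤u eq = ⊓-nested⁻ (11# u w) (10# u w) (01# u w) (00# u w) (subst (_< D) (card-∩-∁ u w) u<D)
      (trans (sym (cong₂ _+_ (card-∩-∁ u w) (card-∩-∁ (∁ u) w))) (card-total u))
      (trans (cong₂ _+_ (trans (sym (dist-fold u w)) eq) (sym (card-∩-∁ʳ u w)))
             (trans (m∸n+n≡m w≤u) (card-∩-∁ u w)))

    -- For u, v of size at most D and k ≤ |u|, |v|: z has level k and lies on geodesics from 𝟎 to
    -- both vertices. These z are the ones that contribute to an entry of `Through`.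
    Between : ℕ → SubS → SubS → X → Set
    Between k u v z = dist 𝟎 z ≡ k × dist (fold u) z ≡ ∣ u ∣ ∸ k × dist z (fold v) ≡ ∣ v ∣ ∸ k

    -- Both distance conditions are read on the same lift `p₁ z`, so the inclusions in u and in v
    -- combine to one in u ∩ v.
    between⇒⊆ : ∀ u v {k z} → ∣ u ∣ < D → ∣ v ∣ < D → k ≤ ∣ u ∣ → k ≤ ∣ v ∣ → Between k u v z →
                ∃ λ w → fold w ≡ z × ∣ w ∣ ≡ k × 01# (u ∩ v) w ≡ 0
    between⇒⊆ u v {k} {z} u<D v<D k≤u k≤v (dk , du , dv) = w , fw , wk
      , ⊆∩ u v w (dist-⊆⁻ u w u<D (subst (_≤ ∣ u ∣) (sym wk) k≤u)
                   (trans (cong (dist (fold u)) fw) (trans du (cong (∣ u ∣ ∸_) (sym wk)))))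
                 (dist-⊆⁻ v w v<D (subst (_≤ ∣ v ∣) (sym wk) k≤v)
                   (trans (cong (dist (fold v)) fw) (trans (dist-comm (fold v) z) (trans dv (cong (∣ v ∣ ∸_) (sym wk))))))
      where
      w = p₁ z
      fw = fold-p₁ z
      wk : ∣ w ∣ ≡ k
      wk = trans (sym (dist-𝟎 w (card-p₁ z))) (trans (cong (dist 𝟎) fw) dk)

    between⇒≤ : ∀ u v {k z} → ∣ u ∣ < D → ∣ v ∣ < D → k ≤ ∣ u ∣ → k ≤ ∣ v ∣ → Between k u v z → k ≤ 11# u v
    between⇒≤ u v u<D v<D k≤u k≤v b with between⇒⊆ u v u<D v<D k≤u k≤v b
    ... | w , _ , refl , w⊆ = subst (∣ w ∣ ≤_) (sym (⊆-card (u ∩ v) w w⊆)) (m≤m+n ∣ w ∣ _)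

    between⇒≡ : ∀ u v {z} → ∣ u ∣ < D → ∣ v ∣ < D → Between (11# u v) u v z → fold (u ∩ v) ≡ z
    between⇒≡ u v u<D v<D b with between⇒⊆ u v u<D v<D (∣p∩q∣≤∣p∣ u v) (∣p∩q∣≤∣q∣ u v) b
    ... | w , refl , wk , w⊆ = cong fold (⊆-card-≡ (u ∩ v) w w⊆ (sym wk))

    between-∩ : ∀ u v → ∣ u ∣ ≤ D → ∣ v ∣ ≤ D → Between (11# u v) u v (fold (u ∩ v))
    between-∩ u v u≤D v≤D =
        dist-𝟎 (u ∩ v) (≤-trans (∣p∩q∣≤∣p∣ u v) u≤D)
      , dist-⊆ u (u ∩ v) u≤D (01#-∩ˡ u v)
      , trans (dist-comm (fold (u ∩ v)) (fold v))
          (dist-⊆ v (u ∩ v) v≤D (trans (cong (01# v) (∩-comm u v)) (01#-∩ˡ v u)))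

open Combinatorics

open import Data.Bool using (true; false; _∧_; T; T?; if_then_else_)
open import Data.Bool.Properties using (T-∧)
open import Data.Fin.Subset using (Subset; inside; outside; ∁; _∩_; ∣_∣)
open import Data.List using (List; map; concatMap; filter; applyUpTo; upTo; _++_) renaming ([] to ε; _∷_ to _﹐_)
open import Data.List.Membership.Propositional using (_∈_)
open import Data.List.Membership.Propositional.Properties using (∈-filter⁻)
open import Data.List.Relation.Unary.Any using (here; there)
open import Data.Nat using (zero; suc; _∸_; _<_; _≡ᵇ_; z≤n; s≤s) renaming (_+_ to _+ℕ_)
open import Data.Nat.Properties using (≡ᵇ⇒≡; ≡⇒≡ᵇ; _≟_; _<?_; suc-injective; +-cancelˡ-≡; +-mono-≤; m+n∸n≡m; m∸n+n≡m; m∸n≤m; m≤n+o⇒m∸n≤o; n≤1+n; ≤-trans; ≤-reflexive; ≤-antisym; ≤∧≢⇒<; <⇒≢; <⇒≱; ≮⇒≥)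
import Data.Nat.Properties as ℕ
open import Data.Product using (∃₂; _,_; proj₁; proj₂)
open import Data.Product.Properties using (≡-dec)
open import Data.Sum using (_⊎_; inj₁; inj₂)
open import Data.Vec using ([]; _∷_)
open import Function using (_∘_; id)
open import Function.Bundles using (mk⇔; Equivalence)
open import Relation.Binary.Definitions using (DecidableEquality)
open import Relation.Binary.PropositionalEquality as ≡ using (_≡_; _≢_; cong; cong₂; subst)
open import Relation.Nullary using (Dec; yes; no; does; ¬_; contradiction; _×-dec_)
open import Relation.Unary using (Pred; Decidable)
import Algebra.Properties.CommutativeSemigroup
import Algebra.Properties.Ring
import Relation.Binary.Reasoning.Setoid

-- Sums over vertices and indices

module Sums {c ℓ : Level} (F : CharZeroField c ℓ) (D : ℕ) where
  open CharZeroField F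
  open Terwilliger F D
  open Algebra.Properties.CommutativeSemigroup +-commutativeSemigroup using (interchange)

  private variable
    n : ℕ
    A B : Set

  +-zero : ∀ {a b} → a ≈ 0# → b ≈ 0# → a + b ≈ 0#
  +-zero p q = trans (+-cong p q) (+-identityˡ 0#)

  sum-cong : ∀ (xs : List A) {f g} → (∀ a → f a ≈ g a) → sumL xs f ≈ sumL xs g
  sum-cong ε        h = refl
  sum-cong (a ﹐ xs) h = +-cong (h a) (sum-cong xs h)

  sum-zero : ∀ (xs : List A) {f} → (∀ a → f a ≈ 0#) → sumL xs f ≈ 0#
  sum-zero ε        h = refl
  sum-zero (a ﹐ xs) h = +-zero (h a) (sum-zero xs h)

  sum-++ : ∀ (xs ys : List A) f → sumL (xs ++ ys) f ≈ sumL xs f + sumL ys f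
  sum-++ ε        ys f = sym (+-identityˡ _)
  sum-++ (a ﹐ xs) ys f = trans (+-congˡ (sum-++ xs ys f)) (sym (+-assoc _ _ _))

  sum-map : ∀ (g : A → B) xs f → sumL (map g xs) f ≈ sumL xs (f ∘ g)
  sum-map g ε        f = refl
  sum-map g (a ﹐ xs) f = +-congˡ (sum-map g xs f)

  sum-concatMap : ∀ (g : A → List B) xs (f : B → Carrier) → sumL (concatMap g xs) f ≈ sumL xs (λ a → sumL (g a) f)
  sum-concatMap g ε        f = refl
  sum-concatMap g (a ﹐ xs) f = trans (sum-++ (g a) (concatMap g xs) f) (+-congˡ (sum-concatMap g xs f))

  sum-filter : ∀ {P : Pred A Level.zero} (P? : Decidable P) xs f →
               sumL (filter P? xs) f ≈ sumL xs (λ a → if does (P? a) then f a else 0#)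
  sum-filter P? ε        f = refl
  sum-filter P? (a ﹐ xs) f with does (P? a)
  ... | true  = +-congˡ (sum-filter P? xs f)
  ... | false = trans (sum-filter P? xs f) (sym (+-identityˡ _))

  sum-applyUpTo-single : ∀ (g : ℕ → A) {n i} f → i < n → (∀ k → k ≢ i → f (g k) ≈ 0#) →
                         sumL (applyUpTo g n) f ≈ f (g i)
  sum-applyUpTo-single g {suc n} {zero}  f _         off =
    trans (+-congˡ (zeros (g ∘ suc) n (λ k → off (suc k) λ ()))) (+-identityʳ _)
    where
    zeros : ∀ g n → (∀ k → f (g k) ≈ 0#) → sumL (applyUpTo g n) f ≈ 0#
    zeros g zero    h = refl
    zeros g (suc n) h = +-zero (h 0) (zeros (g ∘ suc) n (h ∘ suc))
  sum-applyUpTo-single g {suc n} {suc i} f (s≤s i<n) off =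
    trans (+-congʳ (off 0 λ ()))
      (trans (+-identityˡ _) (sum-applyUpTo-single (g ∘ suc) f i<n λ k k≢i → off (suc k) (k≢i ∘ suc-injective)))

  sum-subsets : ∀ (f : Subset (suc n) → Carrier) → sumL (allSubsets (suc n)) f ≈
                sumL (allSubsets n) (f ∘ (outside ∷_)) + sumL (allSubsets n) (f ∘ (inside ∷_))
  sum-subsets {n} f = trans (sum-++ (map (outside ∷_) (allSubsets n)) _ f)
    (+-cong (sum-map (outside ∷_) (allSubsets n) f) (sum-map (inside ∷_) (allSubsets n) f))

  sum-subsets-cong : ∀ (f g : Subset (suc n) → Carrier) →
    sumL (allSubsets n) (f ∘ (outside ∷_)) ≈ sumL (allSubsets n) (g ∘ (outside ∷_)) →
    sumL (allSubsets n) (f ∘ (inside ∷_)) ≈ sumL (allSubsets n) (g ∘ (inside ∷_)) →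
    sumL (allSubsets (suc n)) f ≈ sumL (allSubsets (suc n)) g
  sum-subsets-cong f g p q = trans (sum-subsets f) (trans (+-cong p q) (sym (sum-subsets g)))

  sum-subsets-single : ∀ (x : Subset n) f → (∀ z → x ≢ z → f z ≈ 0#) → sumL (allSubsets n) f ≈ f x
  sum-subsets-single         []            f off = +-identityʳ _
  sum-subsets-single {suc n} (inside  ∷ x) f off = trans (sum-subsets f) (trans
    (+-cong (sum-zero (allSubsets n) λ z → off (outside ∷ z) λ ())
            (sum-subsets-single x (f ∘ (inside ∷_)) λ z x≢z → off (inside ∷ z) λ { ≡.refl → x≢z ≡.refl }))
    (+-identityˡ _))
  sum-subsets-single {suc n} (outside ∷ x) f off = trans (sum-subsets f) (trans
    (+-cong (sum-subsets-single x (f ∘ (outside ∷_)) λ z x≢z → off (outside ∷ z) λ { ≡.refl → x≢z ≡.refl })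
            (sum-zero (allSubsets n) λ z → off (inside ∷ z) λ ()))
    (+-identityʳ _))

  sum-∁ : ∀ n (f : Subset n → Carrier) → sumL (allSubsets n) (f ∘ ∁) ≈ sumL (allSubsets n) f
  sum-∁ zero    f = refl
  sum-∁ (suc n) f = trans (sum-subsets (f ∘ ∁)) (trans (+-cong (sum-∁ n _) (sum-∁ n _))
    (trans (+-comm _ _) (sym (sum-subsets f))))

  -- Only `swap` has content: splitting by the first two coordinates gives four blocks, of which the
  -- middle two change places.
  sum-act : ∀ (π : Perm n) f → sumL (allSubsets n) (f ∘ act π) ≈ sumL (allSubsets n) f
  sum-act done       f = refl
  sum-act (prep π)   f = sum-subsets-cong (f ∘ act (prep π)) f (sum-act π (f ∘ (outside ∷_))) (sum-act π (f ∘ (inside ∷_)))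
  sum-act swap       f = trans (four (f ∘ act swap)) (trans (interchange _ _ _ _) (sym (four f)))
    where
    four : ∀ (g : Subset (suc (suc n)) → Carrier) → sumL (allSubsets (suc (suc n))) g ≈
      (sumL (allSubsets n) (λ z → g (outside ∷ outside ∷ z)) + sumL (allSubsets n) (λ z → g (outside ∷ inside ∷ z)))
      + (sumL (allSubsets n) (λ z → g (inside ∷ outside ∷ z)) + sumL (allSubsets n) (λ z → g (inside ∷ inside ∷ z)))
    four g = trans (sum-subsets g) (+-cong (sum-subsets (g ∘ (outside ∷_))) (sum-subsets (g ∘ (inside ∷_))))
  sum-act (π then ρ) f = trans (sum-act π (f ∘ act ρ)) (sum-act ρ f)

  -- `prep π` fixes element 0 and acts as an ordinary permutation. `swap` moves 0; after folding it
  -- complements the tails of the sets that contain the first remaining element and fixes the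
  -- others.
  sum-· : ∀ (π : Perm (suc n)) f → sumL (allSubsets n) (f ∘ (π ·_)) ≈ sumL (allSubsets n) f
  sum-· done       f = refl
  sum-· (prep π)   f = sum-act π f
  sum-· {suc n} swap f = sum-subsets-cong (f ∘ (swap ·_)) f refl (sum-∁ n (f ∘ (inside ∷_)))
  sum-· {n} (π then ρ) f = trans
    (sum-cong (allSubsets n) λ z → reflexive (cong f (≡.sym (·-fold ρ (act π (outside ∷ z))))))
    (trans (sum-· π (f ∘ (ρ ·_))) (sum-· ρ f))

  indicator-true : ∀ {b} → T b → indicator b ≈ 1#
  indicator-true {true} _ = refl

  indicator-false : ∀ {b} → ¬ T b → indicator b ≈ 0#
  indicator-false {true}  h = contradiction _ h
  indicator-false {false} _ = refl

  indicator-≡ : ∀ {a b} → a ≡ b → indicator (a ≡ᵇ b) ≈ 1#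
  indicator-≡ p = indicator-true (≡⇒≡ᵇ _ _ p)

  indicator-≢ : ∀ {a b} → a ≢ b → indicator (a ≡ᵇ b) ≈ 0#
  indicator-≢ p = indicator-false (p ∘ ≡ᵇ⇒≡ _ _)

  if-yes : ∀ {P : Set} (P? : Dec P) {a b} → P → (if does P? then a else b) ≈ a
  if-yes (yes _) _ = refl
  if-yes (no ¬p) p = contradiction p ¬p

  if-no : ∀ {P : Set} (P? : Dec P) {a b} → ¬ P → (if does P? then a else b) ≈ b
  if-no (yes p) ¬p = contradiction p ¬p
  if-no (no _)  _  = refl

  *-zero : ∀ {a b} → a ≈ 0# ⊎ b ≈ 0# → a * b ≈ 0#
  *-zero (inj₁ p) = trans (*-congʳ p) (zeroˡ _)
  *-zero (inj₂ p) = trans (*-congˡ p) (zeroʳ _)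

  *-one : ∀ {a b} → a ≈ 1# → b ≈ 1# → a * b ≈ 1#
  *-one p q = trans (*-cong p q) (*-identityˡ 1#)

_≟³_ : DecidableEquality (ℕ × ℕ × ℕ)
_≟³_ = ≡-dec _≟_ (≡-dec _≟_ _≟_)

module Algebras {c ℓ : Level} (F : CharZeroField c ℓ) (D : ℕ) (3≤D : 3 ≤ D) where
  open CharZeroField F
  open Terwilliger F D
  open Sums F D
  open Triples D 3≤D
  open Normal
  open Index
  open Algebra.Properties.Ring ring using (-1*x≈-x)
  open Relation.Binary.Reasoning.Setoid setoid

  -- Invariance of T, T ⊆ A and linear independence

  Invariant : Mat → Set ℓ
  Invariant M = ∀ π x y → M (π · x) (π · y) ≈ M x y

  T-invariant : ∀ {M} → InT M → Invariant M
  T-invariant (genA k _) π x y = reflexive (cong (λ d → indicator (d ≡ᵇ k)) (dist-· π x y))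
  T-invariant (genE k _) π x y = reflexive (cong₂ (λ b d → indicator (b ∧ (d ≡ᵇ k)))
    (≡.trans (≡ˢ-dist (π · x) (π · y)) (≡.trans (cong (_≡ᵇ 0) (dist-· π x y)) (≡.sym (≡ˢ-dist x y))))
    (≡.trans (cong (λ o → dist o (π · y)) (≡.sym (·-𝟎 π))) (dist-· π 𝟎 y)))
  T-invariant (add a b) π x y = +-cong (T-invariant a π x y) (T-invariant b π x y)
  T-invariant (smul _ a) π x y = *-congˡ (T-invariant a π x y)
  -- Substituting π · z for the intermediate vertex lets the induction hypotheses apply to both
  -- factors.
  T-invariant (mul {A} {B} a b) π x y = trans
    (sym (sum-· π (λ z → A (π · x) z * B z (π · y))))
    (sum-cong vertices λ z → *-cong (T-invariant a π x z) (T-invariant b π z y))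
  T-invariant (resp A≈B a) π x y = trans (sym (A≈B _ _)) (trans (T-invariant a π x y) (A≈B x y))

  triple-index : ∀ x y → T (inI (triple x y))
  triple-index x y with normal-representative x y
  ... | u , v , _ , _ , N , eq = subst (T ∘ inI) (≡.sym eq) (index⁻ _ _ _ (normal-index N))

  realize-triple : ∀ τ → T (inI τ) → ∃₂ λ x y → triple x y ≡ τ
  realize-triple (i , j , t) h with realize (index i j t h)
  ... | u , v , N , eq = fold u , fold v , ≡.trans (triple-fold N) eq

  ≡ᵇ³-sound : ∀ σ τ → T (σ ≡ᵇ³ τ) → σ ≡ τ
  ≡ᵇ³-sound (a , b , c) (a′ , b′ , c′) h =
    let (p , h) = Equivalence.to T-∧ h
        (q , r) = Equivalence.to T-∧ h
    in cong₂ _,_ (≡ᵇ⇒≡ a a′ p) (cong₂ _,_ (≡ᵇ⇒≡ b b′ q) (≡ᵇ⇒≡ c c′ r))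

  ≡ᵇ³-refl : ∀ τ → T (τ ≡ᵇ³ τ)
  ≡ᵇ³-refl (a , b , c) = Equivalence.from T-∧ (≡⇒≡ᵇ a a ≡.refl , Equivalence.from T-∧ (≡⇒≡ᵇ b b ≡.refl , ≡⇒≡ᵇ c c ≡.refl))

  Mtij-≡ : ∀ τ x y → triple x y ≡ τ → Mtij τ x y ≈ 1#
  Mtij-≡ τ x y ≡.refl = indicator-true (≡ᵇ³-refl τ)

  Mtij-≢ : ∀ τ x y → triple x y ≢ τ → Mtij τ x y ≈ 0#
  Mtij-≢ τ x y h = indicator-false (h ∘ ≡ᵇ³-sound _ _)

  -- The sum is moved back to the unfiltered `box`, with zeros off 𝓘, and then collapses one
  -- coordinate at a time.
  sum-𝓘-single : ∀ σ f → T (inI σ) → (∀ τ → τ ≢ σ → f τ ≈ 0#) → sumL 𝓘 f ≈ f σ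
  sum-𝓘-single σ@(i , j , t) f σ∈𝓘 off = begin
    sumL 𝓘 f
      ≈⟨ sum-filter (λ τ → T? (inI τ)) box f ⟩
    sumL box g
      ≈⟨ sum-concatMap plane (upTo (suc D)) g ⟩
    sumL (upTo (suc D)) (λ i′ → sumL (plane i′) g)
      ≈⟨ sum-cong (upTo (suc D)) (λ i′ → trans (sum-concatMap (line i′) (upTo (suc D)) g)
           (sum-cong (upTo (suc D)) λ j′ → sum-map (λ t′ → i′ , j′ , t′) (upTo (suc D)) g)) ⟩
    sumL (upTo (suc D)) (λ i′ → sumL (upTo (suc D)) (λ j′ → sumL (upTo (suc D)) (λ t′ → g (i′ , j′ , t′))))
      ≈⟨ sum-applyUpTo-single id _ (s≤s (i≤D I)) (λ i′ i′≢i → sum-zero (upTo (suc D)) λ j′ →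
           sum-zero (upTo (suc D)) λ t′ → g-off _ (i′≢i ∘ cong proj₁)) ⟩
    sumL (upTo (suc D)) (λ j′ → sumL (upTo (suc D)) (λ t′ → g (i , j′ , t′)))
      ≈⟨ sum-applyUpTo-single id _ (s≤s (j≤D I)) (λ j′ j′≢j →
           sum-zero (upTo (suc D)) λ t′ → g-off _ (j′≢j ∘ cong (proj₁ ∘ proj₂))) ⟩
    sumL (upTo (suc D)) (λ t′ → g (i , j , t′))
      ≈⟨ sum-applyUpTo-single id _ (s≤s (≤-trans (t≤i I) (i≤D I))) (λ t′ t′≢t → g-off _ (t′≢t ∘ cong (proj₂ ∘ proj₂))) ⟩
    g σ
      ≈⟨ if-yes (T? (inI σ)) σ∈𝓘 ⟩
    f σ ∎
    where
    I = index i j t σ∈𝓘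
    line : ℕ → ℕ → List (ℕ × ℕ × ℕ)
    line i′ j′ = map (λ t′ → i′ , j′ , t′) (upTo (suc D))
    plane : ℕ → List (ℕ × ℕ × ℕ)
    plane i′ = concatMap (line i′) (upTo (suc D))
    g : ℕ × ℕ × ℕ → Carrier
    g τ = if does (T? (inI τ)) then f τ else 0#
    g-off : ∀ τ → τ ≢ σ → g τ ≈ 0#
    g-off τ h with does (T? (inI τ))
    ... | true  = off τ h
    ... | false = refl

  -- The supports of the matrices partition X × X, so an entry of a combination is a single
  -- coefficient. Spanning and independence are both read off from this.
  combo-entry : ∀ coef x y → combo coef x y ≈ coef (triple x y)
  combo-entry coef x y = trans
    (sum-𝓘-single (triple x y) _ (triple-index x y)
      λ τ τ≢ → *-zero (inj₂ (Mtij-≢ τ x y (τ≢ ∘ ≡.sym))))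
    (trans (*-congˡ (Mtij-≡ (triple x y) x y ≡.refl)) (*-identityʳ _))

  -- The entry at a chosen pair of the orbit labelled τ. The value off 𝓘 is arbitrary, as no
  -- combination reads it.
  coefficient : Mat → ℕ × ℕ × ℕ → Carrier
  coefficient M τ with T? (inI τ)
  ... | yes τ∈𝓘 = let (x , y , _) = realize-triple τ τ∈𝓘 in M x y
  ... | no  _   = 0#

  coefficient-≈ : ∀ {M} → Invariant M → ∀ x y τ → triple x y ≡ τ → T (inI τ) → M x y ≈ coefficient M τ
  coefficient-≈ {M} inv x y τ eq τ∈𝓘 with T? (inI τ)
  ... | no τ∉𝓘 = contradiction τ∈𝓘 τ∉𝓘
  ... | yes τ∈𝓘 =
    let (x′ , y′ , eq′) = realize-triple τ τ∈𝓘
        (π , πx , πy)   = orbit x y x′ y′ (≡.trans eq (≡.sym eq′))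
    in trans (sym (inv π x y)) (reflexive (cong₂ M πx πy))

  invariant-entry : ∀ {M} → Invariant M → ∀ x y → M x y ≈ coefficient M (triple x y)
  invariant-entry inv x y = coefficient-≈ inv x y (triple x y) ≡.refl (triple-index x y)

  T⊆A : ∀ {M} → InT M → InA M
  T⊆A {M} M∈T = coefficient M , λ x y → trans (invariant-entry (T-invariant M∈T) x y) (sym (combo-entry (coefficient M) x y))

  linIndep : LinIndep
  linIndep coef vanish τ τ∈𝓘 with realize-triple τ (proj₂ (∈-filter⁻ (λ τ → T? (inI τ)) {xs = box} τ∈𝓘))
  ... | x , y , ≡.refl = trans (sym (combo-entry coef x y)) (vanish x y)

  -- A ⊆ T

  T-𝟘 : InT 𝟘
  T-𝟘 = resp (λ x y → zeroˡ _) (smul 0# (genA 0 z≤n))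

  T-sum : ∀ (τs : List (ℕ × ℕ × ℕ)) (f : ℕ × ℕ × ℕ → Mat) → (∀ τ → τ ∈ τs → InT (f τ)) →
          InT (λ x y → sumL τs (λ τ → f τ x y))
  T-sum ε        f h = T-𝟘
  T-sum (τ ﹐ τs) f h = add (h τ (here ≡.refl)) (T-sum τs f λ σ σ∈τs → h σ (there σ∈τs))

  -- Membership is asked of the scaled matrices, so a term with coefficient zero demands nothing of
  -- `Mtij τ`; the induction on t relies on this.
  T-combo : ∀ coef → (∀ τ → T (inI τ) → InT (coef τ • Mtij τ)) → InT (combo coef)
  T-combo coef h = T-sum 𝓘 (λ τ → coef τ • Mtij τ)
    λ τ τ∈𝓘 → h τ (proj₂ (∈-filter⁻ (λ τ → T? (inI τ)) {xs = box} τ∈𝓘))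

  Estar-≢ : ∀ k x y → x ≢ y → Estar k x y ≈ 0#
  Estar-≢ k x y x≢y with x ≡ˢ y in eq
  ... | true  = contradiction (≡ˢ⇒≡ x y eq) x≢y
  ... | false = refl

  Estar-diagonal : ∀ k x → Estar k x x ≈ indicator (dist 𝟎 x ≡ᵇ k)
  Estar-diagonal k x = reflexive (cong (λ b → indicator (b ∧ (dist 𝟎 x ≡ᵇ k))) (≡ˢ-refl x))

  Estar-⊗ : ∀ i B x y → (Estar i ⊗ B) x y ≈ indicator (dist 𝟎 x ≡ᵇ i) * B x y
  Estar-⊗ i B x y = trans
    (sum-subsets-single x (λ z → Estar i x z * B z y) λ z x≢z → *-zero (inj₁ (Estar-≢ i x z x≢z)))
    (*-congʳ (Estar-diagonal i x))

  ⊗-Estar : ∀ j B x y → (B ⊗ Estar j) x y ≈ B x y * indicator (dist 𝟎 y ≡ᵇ j)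
  ⊗-Estar j B x y = trans
    (sum-subsets-single y (λ z → B x z * Estar j z y) λ z y≢z → *-zero (inj₂ (Estar-≢ j z y (y≢z ∘ ≡.sym))))
    (*-congˡ (Estar-diagonal j y))

  Block : ℕ → ℕ → ℕ → Mat
  Block i k j = Estar i ⊗ (Adist k ⊗ Estar j)

  block∈T : ∀ {i k j} → i ≤ D → k ≤ D → j ≤ D → InT (Block i k j)
  block∈T {i} {k} {j} p q r = mul {Estar i} {Adist k ⊗ Estar j} (genE i p) (mul {Adist k} {Estar j} (genA k q) (genE j r))

  block-entry : ∀ i k j x y → Block i k j x y ≈
                indicator (dist 𝟎 x ≡ᵇ i) * (indicator (dist x y ≡ᵇ k) * indicator (dist 𝟎 y ≡ᵇ j))
  block-entry i k j x y = trans (Estar-⊗ i (Adist k ⊗ Estar j) x y) (*-congˡ (⊗-Estar j (Adist k) x y))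

  block-one : ∀ i k j x y → dist 𝟎 x ≡ i → dist x y ≡ k → dist 𝟎 y ≡ j → Block i k j x y ≈ 1#
  block-one i k j x y p q r = trans (block-entry i k j x y)
    (*-one (indicator-≡ p) (*-one (indicator-≡ q) (indicator-≡ r)))

  block-zero : ∀ i k j x y → ¬ (dist 𝟎 x ≡ i × dist x y ≡ k × dist 𝟎 y ≡ j) → Block i k j x y ≈ 0#
  block-zero i k j x y h = trans (block-entry i k j x y) zero-product
    where
    zero-product : indicator (dist 𝟎 x ≡ᵇ i) * (indicator (dist x y ≡ᵇ k) * indicator (dist 𝟎 y ≡ᵇ j)) ≈ 0#
    zero-product with dist 𝟎 x ≟ i | dist x y ≟ k | dist 𝟎 y ≟ j
    ... | no p  | _     | _     = *-zero (inj₁ (indicator-≢ p))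
    ... | yes p | no q  | _     = *-zero (inj₂ (*-zero (inj₁ (indicator-≢ q))))
    ... | yes p | yes q | no r  = *-zero (inj₂ (*-zero (inj₂ (indicator-≢ r))))
    ... | yes p | yes q | yes r = contradiction (p , q , r) h

  triple-dist-𝟎 : ∀ x y → dist 𝟎 x ≡ proj₁ (triple x y) × dist 𝟎 y ≡ proj₁ (proj₂ (triple x y))
  triple-dist-𝟎 x y with normal-representative x y
  ... | u , v , ≡.refl , ≡.refl , N , eq =
      ≡.trans (dist-𝟎 u (cardˡ N)) (≡.sym (cong proj₁ eq))
    , ≡.trans (dist-𝟎 v (cardʳ N)) (≡.sym (cong (proj₁ ∘ proj₂) eq))

  triple-dist-middle : ∀ x y {i j t} → triple x y ≡ (i , j , t) → i ≡ D ⊎ j ≡ D → dist x y +ℕ (t +ℕ t) ≡ i +ℕ j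
  triple-dist-middle x y eq middle with normal-representative x y
  ... | u , v , ≡.refl , ≡.refl , N , eq′ with ≡.trans (≡.sym eq′) eq
  ... | ≡.refl = dist-middle N middle

  middle∈T : ∀ {i j t} → Index i j t → i ≡ D ⊎ j ≡ D → InT (Mtij (i , j , t))
  middle∈T {i} {j} {t} I middle = resp same (block∈T (i≤D I) (k≤D middle) (j≤D I))
    where
    -- The common distance of all pairs with this triple; the half condition keeps it at most D.
    k = i +ℕ j ∸ (t +ℕ t)
    k≤D : i ≡ D ⊎ j ≡ D → k ≤ D
    k≤D (inj₁ i≡D) = m≤n+o⇒m∸n≤o (i +ℕ j) (t +ℕ t) (≤-trans (+-mono-≤ (i≤D I) (midˡ I i≡D)) (≤-reflexive (ℕ.+-comm D (t +ℕ t))))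
    k≤D (inj₂ j≡D) = m≤n+o⇒m∸n≤o (i +ℕ j) (t +ℕ t) (+-mono-≤ (midʳ I j≡D) (j≤D I))
    double-injective : ∀ {a b} → a +ℕ a ≡ b +ℕ b → a ≡ b
    double-injective eq = ≤-antisym (halve-≤ (≤-trans (≤-reflexive eq) (n≤1+n _)))
                                    (halve-≤ (≤-trans (≤-reflexive (≡.sym eq)) (n≤1+n _)))
    same : Block i k j ≈ₘ Mtij (i , j , t)
    same x y with triple x y ≟³ (i , j , t)
    ... | yes eq = trans
      (block-one i k j x y (≡.trans (proj₁ (triple-dist-𝟎 x y)) (cong proj₁ eq))
        (≡.trans (≡.sym (m+n∸n≡m (dist x y) (t +ℕ t))) (cong (_∸ (t +ℕ t)) (triple-dist-middle x y eq middle)))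
        (≡.trans (proj₂ (triple-dist-𝟎 x y)) (cong (proj₁ ∘ proj₂) eq)))
      (sym (Mtij-≡ (i , j , t) x y eq))
    ... | no neq = trans (block-zero i k j x y (neq ∘ determined)) (sym (Mtij-≢ (i , j , t) x y neq))
      where
      determined : dist 𝟎 x ≡ i × dist x y ≡ k × dist 𝟎 y ≡ j → triple x y ≡ (i , j , t)
      -- The levels give i and j; then k + 2t′ = i + j = k + 2t yields t′ = t.
      determined (p , q , r) = cong₂ _,_ eᵢ (cong₂ _,_ eⱼ (double-injective (+-cancelˡ-≡ k _ _ (≡.trans
          (subst (λ d → d +ℕ (t′ +ℕ t′) ≡ i +ℕ j) q (triple-dist-middle x y (cong₂ _,_ eᵢ (cong (_, t′) eⱼ)) middle))
          (≡.sym (m∸n+n≡m (+-mono-≤ (t≤i I) (t≤j I))))))))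
        where
        t′ = proj₂ (proj₂ (triple x y))
        eᵢ = ≡.trans (≡.sym (proj₁ (triple-dist-𝟎 x y))) p
        eⱼ = ≡.trans (≡.sym (proj₂ (triple-dist-𝟎 x y))) r

  -- For i , j < D and k ≤ i , j, the (x , y) entry with |x₁| = i and |y₁| = j is the number of
  -- k-subsets of x₁ ∩ y₁.
  Through : ℕ → ℕ → ℕ → Mat
  Through i j k = Block i (i ∸ k) k ⊗ Block k (j ∸ k) j

  through∈T : ∀ {i j k} → i ≤ D → j ≤ D → k ≤ D → InT (Through i j k)
  through∈T {i} {j} {k} p q r = mul {Block i (i ∸ k) k} {Block k (j ∸ k) j} (block∈T p (≤-trans (m∸n≤m i k) p) r) (block∈T r (≤-trans (m∸n≤m j k) q) q)

  through-term-zero : ∀ i j k x y z →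
    ¬ (dist 𝟎 x ≡ i × dist 𝟎 y ≡ j × dist 𝟎 z ≡ k × dist x z ≡ i ∸ k × dist z y ≡ j ∸ k) →
    Block i (i ∸ k) k x z * Block k (j ∸ k) j z y ≈ 0#
  through-term-zero i j k x y z h
    with dist 𝟎 x ≟ i | dist x z ≟ i ∸ k | dist 𝟎 z ≟ k
  ... | no p  | _     | _     = *-zero (inj₁ (block-zero i (i ∸ k) k x z (p ∘ proj₁)))
  ... | yes p | no q  | _     = *-zero (inj₁ (block-zero i (i ∸ k) k x z (q ∘ proj₁ ∘ proj₂)))
  ... | yes p | yes q | no r  = *-zero (inj₁ (block-zero i (i ∸ k) k x z (r ∘ proj₂ ∘ proj₂)))
  ... | yes p | yes q | yes r = *-zero (inj₂ (block-zero k (j ∸ k) j z y λ (_ , s , e) → h (p , e , r , q , s)))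

  through-off-block : ∀ i j k x y → ¬ (dist 𝟎 x ≡ i × dist 𝟎 y ≡ j) → Through i j k x y ≈ 0#
  through-off-block i j k x y h = sum-zero vertices λ z →
    through-term-zero i j k x y z λ (p , q , _) → h (p , q)

  -- A t-set with t < k has no k-subset, so every summand vanishes.
  through-below : ∀ k x y {i j t} → i < D → j < D → k ≤ i → k ≤ j → triple x y ≡ (i , j , t) → t < k →
                  Through i j k x y ≈ 0#
  through-below k x y i<D j<D k≤i k≤j eq t<k with normal-representative x y
  ... | u , v , ≡.refl , ≡.refl , N , eq′ with ≡.trans (≡.sym eq′) eq
  ... | ≡.refl = sum-zero vertices λ z → through-term-zero ∣ u ∣ ∣ v ∣ k x y z
    λ (_ , _ , b) → <⇒≱ t<k (between⇒≤ u v i<D j<D k≤i k≤j b)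

  -- The only k-subset of a k-set is the set itself, so the single surviving summand is at
  -- `fold (u ∩ v)`.
  through-diagonal : ∀ x y {i j k} → i < D → j < D → triple x y ≡ (i , j , k) → Through i j k x y ≈ 1#
  through-diagonal x y i<D j<D eq with normal-representative x y
  ... | u , v , ≡.refl , ≡.refl , N , eq′ with ≡.trans (≡.sym eq′) eq
  ... | ≡.refl = trans
    (sum-subsets-single (fold (u ∩ v)) (λ z → Block i (i ∸ k) k x z * Block k (j ∸ k) j z y)
      λ z z≢ → through-term-zero i j k x y z λ (_ , _ , b) → z≢ (between⇒≡ u v i<D j<D b))
    (*-one (block-one i (i ∸ k) k x (fold (u ∩ v)) (dist-𝟎 u (cardˡ N)) (proj₁ (proj₂ between)) (proj₁ between))
           (block-one k (j ∸ k) j (fold (u ∩ v)) y (proj₁ between) (proj₂ (proj₂ between)) (dist-𝟎 v (cardʳ N))))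
    where
    i = ∣ u ∣
    j = ∣ v ∣
    k = 11# u v
    between = between-∩ u v (cardˡ N) (cardʳ N)

  -- Through i j t is M^t_ij plus a combination of the M^s_ij with s > t.
  lower∈T : ∀ {i j t} → Index i j t → i < D → j < D →
            (∀ s → t < s → Index i j s → InT (Mtij (i , j , s))) → InT (Mtij (i , j , t))
  lower∈T {i} {j} {t} I i<D j<D above∈T =
    resp same (add through∈ (smul (- 1#) (T-combo upper upper∈T)))
    where
    N = Through i j t
    through∈ = through∈T (i≤D I) (j≤D I) (≤-trans (t≤i I) (i≤D I))
    Above : ℕ × ℕ × ℕ → Set
    Above (i′ , j′ , s) = i′ ≡ i × j′ ≡ j × t < s
    above? : ∀ τ → Dec (Above τ)
    above? (i′ , j′ , s) = (i′ ≟ i) ×-dec ((j′ ≟ j) ×-dec (t <? s))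
    -- The entries of `N` itself for s > t, cut off to zero elsewhere, so that subtracting
    -- `combo upper` clears exactly these.
    upper : ℕ × ℕ × ℕ → Carrier
    upper τ = if does (above? τ) then coefficient N τ else 0#
    upper∈T : ∀ τ → T (inI τ) → InT (upper τ • Mtij τ)
    upper∈T τ τ∈𝓘 = by-cases (above? τ)
      where
      by-cases : Dec (Above τ) → InT (upper τ • Mtij τ)
      by-cases (yes (≡.refl , ≡.refl , t<s)) = smul (upper τ) (above∈T _ t<s (index _ _ _ τ∈𝓘))
      by-cases (no ¬a) = resp (λ x y → sym (*-zero (inj₁ (if-no (above? τ) ¬a)))) T-𝟘
    subtract-zero : ∀ {a b} → b ≈ 0# → a + (- 1#) * b ≈ a
    subtract-zero p = trans (+-congˡ (*-zero (inj₂ p))) (+-identityʳ _)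
    subtract-self : ∀ {a b} → b ≈ a → a + (- 1#) * b ≈ 0#
    subtract-self {a} p = trans (+-congˡ (trans (*-congˡ p) (-1*x≈-x a))) (-‿inverseʳ a)
    same : (N ⊕ ((- 1#) • combo upper)) ≈ₘ Mtij (i , j , t)
    same x y = trans (+-congˡ (*-congˡ (combo-entry upper x y))) (entry (triple x y) ≡.refl)
      where
      entry : ∀ σ → triple x y ≡ σ → N x y + (- 1#) * upper σ ≈ Mtij (i , j , t) x y
      entry σ@(i′ , j′ , s) eq = by-cases (above? σ)
        where
        off-block : ¬ (i′ ≡ i × j′ ≡ j) → N x y ≈ Mtij (i , j , t) x y
        off-block h = trans
          (through-off-block i j t x y λ (p , q) → h ( ≡.trans (≡.sym (cong proj₁ eq)) (≡.trans (≡.sym (proj₁ (triple-dist-𝟎 x y))) p)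
                                           , ≡.trans (≡.sym (cong (proj₁ ∘ proj₂) eq)) (≡.trans (≡.sym (proj₂ (triple-dist-𝟎 x y))) q)))
          (sym (Mtij-≢ (i , j , t) x y λ eq′ → h (cong proj₁ (≡.trans (≡.sym eq) eq′) , cong (proj₁ ∘ proj₂) (≡.trans (≡.sym eq) eq′))))
        not-above : ¬ Above σ → Dec (i′ ≡ i) → Dec (j′ ≡ j) → Dec (s ≡ t) → N x y ≈ Mtij (i , j , t) x y
        not-above ¬a (no p) _ _ = off-block (p ∘ proj₁)
        not-above ¬a (yes _) (no q) _ = off-block (q ∘ proj₂)
        not-above ¬a (yes ≡.refl) (yes ≡.refl) (yes ≡.refl) =
          trans (through-diagonal x y i<D j<D eq) (sym (Mtij-≡ (i , j , t) x y eq))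
        not-above ¬a (yes ≡.refl) (yes ≡.refl) (no r) =
          trans (through-below t x y i<D j<D (t≤i I) (t≤j I) eq (≤∧≢⇒< (≮⇒≥ λ t<s → ¬a (≡.refl , ≡.refl , t<s)) r))
                (sym (Mtij-≢ (i , j , t) x y λ eq′ → r (cong (proj₂ ∘ proj₂) (≡.trans (≡.sym eq) eq′))))
        by-cases : Dec (Above σ) → N x y + (- 1#) * upper σ ≈ Mtij (i , j , t) x y
        by-cases (yes a@(_ , _ , t<s)) = trans
          (subtract-self (trans (if-yes (above? σ) a) (sym
            (trans (invariant-entry (T-invariant through∈) x y) (reflexive (cong (coefficient N) eq))))))
          (sym (Mtij-≢ (i , j , t) x y λ eq′ → <⇒≢ t<s (cong (proj₂ ∘ proj₂) (≡.trans (≡.sym eq′) eq))))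
        by-cases (no ¬a) = trans (subtract-zero (if-no (above? σ) ¬a)) (not-above ¬a (i′ ≟ i) (j′ ≟ j) (s ≟ t))

  -- The downward induction is made structural by d, which bounds the gap from t to D and shrinks as
  -- t grows.
  Mtij∈T : ∀ {i j} d t → D ≤ t +ℕ d → Index i j t → InT (Mtij (i , j , t))
  Mtij∈T {i} {j} d t fuel I with i ≟ D | j ≟ D
  ... | yes i≡D | _       = middle∈T I (inj₁ i≡D)
  ... | no  _   | yes j≡D = middle∈T I (inj₂ j≡D)
  ... | no  i≢D | no  j≢D = lower∈T I (≤∧≢⇒< (i≤D I) i≢D) (≤∧≢⇒< (j≤D I) j≢D) (above d fuel)
    where
    above : ∀ d → D ≤ t +ℕ d → ∀ s → t < s → Index i j s → InT (Mtij (i , j , s))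
    -- With d exhausted, D ≤ t < s contradicts s ≤ i ≤ D.
    above zero    fuel s t<s J = contradiction
      (≤-trans (t≤i J) (≤-trans (i≤D J) (≤-trans fuel (≤-reflexive (ℕ.+-identityʳ t))))) (<⇒≱ t<s)
    above (suc d) fuel s t<s J = Mtij∈T d s
      (≤-trans fuel (≤-trans (≤-reflexive (ℕ.+-suc t d)) (ℕ.+-monoˡ-≤ d t<s))) J

  A⊆T : ∀ {M} → InA M → InT M
  A⊆T (coef , M≈) = resp (λ x y → sym (M≈ x y)) (T-combo coef λ (i , j , t) τ∈𝓘 →
    smul (coef (i , j , t)) (Mtij∈T D t (ℕ.m≤n+m D t) (index i j t τ∈𝓘)))

theorem3p8 : ∀ {c ℓ : Level} (F : CharZeroField c ℓ) (D : ℕ) → 3 ≤ D →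
    ((M : Terwilliger.Mat F D) → Terwilliger.InT F D M ⇔ Terwilliger.InA F D M)
    × Terwilliger.LinIndep F D
theorem3p8 F D 3≤D = (λ M → mk⇔ T⊆A A⊆T) , linIndep
  where
  open Algebras F D 3≤D
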